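{- Let $n\ge1$ and $P=\{(i,j)\colon1\le i\le j\le n\}$ be the shifted staircase. Then $\sum_{p\in P}T_p^-\equiv^q \frac{\binom{n+1}{2}_q}{[2n]_q}$.
   Context: $P$ is ordered by $(i,j)\le(i',j')$ iff $i\le i'$ and $j\le j'$. $\mathcal{J}(P)$ is the set of order ideals. For $p\in P$, $I\in\mathcal{J}(P)$: $T_p^+(I)=1$ if $p$ is minimal in $P\setminus I$, else $0$; $T_p^-(I)=1$ if $p$ is maximal in $I$, else $0$; $T_p^q=T_p^+-qT_p^-$ with $q$ an indeterminate. For $f,g\colon\mathcal{J}(P)\to\mathbb{R}(q)$, $f\equiv^q g$ means $f-g=\sum_{p\in P}c_p(q)T_p^q$ for some $c_p(q)\in\mathbb{R}(q)$; an element of $\mathbb{R}(q)$ denotes a constant function. $[m]_q=1+q+\dots+q^{m-1}$, $[m]_q!=[m]_q[m-1]_q\cdots[1]_q$, and $\binom{m}{k}_q=\frac{[m]_q!}{[k]_q![m-k]_q!}$. -}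

module Defs where

open import Algebra.Apartness.Bundles using (HeytingCommutativeRing; HeytingField)
import Algebra.Apartness.Properties.HeytingCommutativeRing as HeytingProperties
open import Algebra.Bundles using (CommutativeRing)
import Algebra.Definitions.RawMonoid as RawMonoidDefinitions
import Algebra.Properties.AbelianGroup as AbelianGroupProperties
open import Data.Bool.Base using (Bool; T; if_then_else_)
open import Data.Bool.Properties using (T?)
open import Data.List.Base using (List; []; _∷_; map; mapMaybe; foldr; replicate; upTo; cartesianProduct)
open import Data.List.Membership.Propositional using (_∈_)
open import Data.List.Membership.Propositional.Properties using (∈-upTo⁺; ∈-cartesianProduct⁺)
open import Data.List.Relation.Unary.All using (All; []; _∷_; all?; tabulate; lookup)
open import Data.List.Relation.Unary.Any using (here; there)
open import Data.List.Relation.Unary.AllPairs using (AllPairs; []; _∷_)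
open import Data.List.Relation.Unary.Unique.Propositional using (Unique)
import Data.List.Relation.Unary.Unique.Propositional.Properties as UniqueProperties
open import Data.Maybe.Base using (Maybe; just; nothing)
open import Data.Nat.Base as ℕ using (ℕ; zero; suc; _∸_; _≤_; z≤n; s≤s)
import Data.Nat.Properties as ℕₚ
open import Data.Product.Base using (Σ-syntax; ∃-syntax; _×_; _,_; proj₁; proj₂)
open import Data.Sum.Base using (_⊎_; inj₁; inj₂)
open import Level using (_⊔_) renaming (suc to lsuc)
open import Relation.Binary.Core using (Rel)
open import Relation.Binary.PropositionalEquality as ≡ using (_≡_; _≢_)
open import Relation.Binary.Structures using (IsStrictPartialOrder)
open import Relation.Nullary using (¬_; Dec; yes; no; does; contradiction)
open import Relation.Nullary.Negation using (contradiction-irr)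
open import Relation.Nullary.Decidable using (map′; recompute; ¬?; _×-dec_; _→-dec_)

-- The real numbers, given axiomatically as a Cauchy complete
-- Archimedean ordered field.  The apartness x # y is "x < y or y < x";
-- classically it says that x and y are different.

record RealNumbers c ℓ₁ ℓ₂ ℓ₃ : Set (lsuc (c ⊔ ℓ₁ ⊔ ℓ₂ ⊔ ℓ₃)) where
  field
    heytingField : HeytingField c ℓ₁ ℓ₂

  open HeytingField heytingField public
  open RawMonoidDefinitions
    (CommutativeRing.+-rawMonoid
      (HeytingCommutativeRing.commutativeRing heytingCommutativeRing))
    public using () renaming (_×_ to _·_)

  infix 4 _<_
  field
    _<_                  : Rel Carrier ℓ₃
    isStrictPartialOrder : IsStrictPartialOrder _≈_ _<_
    #⇒<⊎>                : ∀ {x y} → x # y → x < y ⊎ y < x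
    <⇒#                  : ∀ {x y} → x < y → x # y
    +-monoˡ-<            : ∀ z {x y} → x < y → x + z < y + z
    *-pos                : ∀ {x y} → 0# < x → 0# < y → 0# < x * y
    archimedean          : ∀ x → ∃[ k ] x < k · 1#

  -- No absolute value is needed: k and m may be interchanged.
  IsCauchy : (ℕ → Carrier) → Set (c ⊔ ℓ₃)
  IsCauchy s = ∀ ε → 0# < ε → ∃[ N ] (∀ k m → N ≤ k → N ≤ m → s k - s m < ε)

  _⟶_ : (ℕ → Carrier) → Carrier → Set (c ⊔ ℓ₃)
  s ⟶ l = ∀ ε → 0# < ε →
    ∃[ N ] (∀ k → N ≤ k → (s k - l < ε) × (l - s k < ε))

  field
    complete : ∀ s → IsCauchy s → ∃[ l ] s ⟶ l

-- Polynomials in one indeterminate, as lists of coefficients with the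
-- constant term first.  Trailing zeros are allowed, and equality is
-- equality of all coefficients.

module Polynomials {c ℓ₁ ℓ₂} (F : HeytingField c ℓ₁ ℓ₂) where

  open HeytingField F
  open HeytingProperties heytingCommutativeRing
  private
    module R = CommutativeRing (HeytingCommutativeRing.commutativeRing heytingCommutativeRing)
  open AbelianGroupProperties R.+-abelianGroup using (xyx⁻¹≈y)

  Poly : Set c
  Poly = List Carrier

  coeff : Poly → ℕ → Carrier
  coeff []      _       = 0#
  coeff (a ∷ p) zero    = a
  coeff (a ∷ p) (suc k) = coeff p k

  infix  4 _≈ₚ_
  infixl 6 _+ₚ_
  infixl 7 _*ₚ_
  infix  8 -ₚ_

  _≈ₚ_ : Poly → Poly → Set ℓ₁
  p ≈ₚ r = ∀ k → coeff p k ≈ coeff r k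

  -- Classically, p is not the zero polynomial.
  Nonzeroₚ : Poly → Set ℓ₂
  Nonzeroₚ p = ∃[ k ] coeff p k # 0#

  _+ₚ_ : Poly → Poly → Poly
  []      +ₚ r       = r
  (a ∷ p) +ₚ []      = a ∷ p
  (a ∷ p) +ₚ (b ∷ r) = (a + b) ∷ (p +ₚ r)

  -ₚ_ : Poly → Poly
  -ₚ p = map -_ p

  _*ₚ_ : Poly → Poly → Poly
  []      *ₚ r = []
  (a ∷ p) *ₚ r = map (a *_) r +ₚ (0# ∷ (p *ₚ r))

  private
    [x+y]-y≈x : ∀ x y → (x + y) - y ≈ x
    [x+y]-y≈x x y = trans (+-congʳ (+-comm x y)) (xyx⁻¹≈y y x)

    x#0⇒x+y#y : ∀ {x y} → x # 0# → x + y # y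
    x#0⇒x+y#y {x} {y} h with #⇒invertible h
    ... | i , e , _ = invertibleˡ⇒#
      (i , trans (*-congˡ (trans ([x+y]-y≈x x y) (sym (x-0≈x x)))) e)

    x+y#y⇒x#0 : ∀ {x y} → x + y # y → x # 0#
    x+y#y⇒x#0 {x} {y} h with #⇒invertible h
    ... | i , e , _ = invertibleˡ⇒#
      (i , trans (*-congˡ (trans (x-0≈x x) (sym ([x+y]-y≈x x y)))) e)

    x+y#0⇒ : ∀ {x y} → x + y # 0# → x # 0# ⊎ y # 0#
    x+y#0⇒ {x} {y} h with #-cotrans h y
    ... | inj₁ a = inj₁ (x+y#y⇒x#0 a)
    ... | inj₂ b = inj₂ b

    x#0⇒ : ∀ {x} y → x # 0# → x + y # 0# ⊎ y # 0#
    x#0⇒ y h with #-cotrans (x#0⇒x+y#y {y = y} h) 0#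
    ... | inj₁ a = inj₁ a
    ... | inj₂ b = inj₂ (#-sym b)

    x*y#0⇒y#0 : ∀ {x y} → x * y # 0# → y # 0#
    x*y#0⇒y#0 {x} {y} h with #⇒invertible h
    ... | i , e , _ = invertibleˡ⇒# (i * x ,
      trans (*-congˡ (x-0≈x y)) (trans (*-assoc i x y)
        (trans (*-congˡ (sym (x-0≈x (x * y)))) e)))

    x*y#0⇒x#0 : ∀ {x y} → x * y # 0# → x # 0#
    x*y#0⇒x#0 h = x*y#0⇒y#0 (#-congʳ (*-comm _ _) h)

    0#0⇒ : ∀ {a} {A : Set a} → 0# # 0# → A
    0#0⇒ h = contradiction h (#-irrefl refl)

    coeff-+ : ∀ p r k → coeff (p +ₚ r) k ≈ coeff p k + coeff r k
    coeff-+ []      r       k       = sym (R.+-identityˡ _)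
    coeff-+ (a ∷ p) []      k       = sym (R.+-identityʳ _)
    coeff-+ (a ∷ p) (b ∷ r) zero    = refl
    coeff-+ (a ∷ p) (b ∷ r) (suc k) = coeff-+ p r k

    coeff-scale : ∀ a p k → coeff (map (a *_) p) k ≈ a * coeff p k
    coeff-scale a []      k       = sym (R.zeroʳ a)
    coeff-scale a (b ∷ p) zero    = refl
    coeff-scale a (b ∷ p) (suc k) = coeff-scale a p k

    coeff-* : ∀ a p r k →
      coeff ((a ∷ p) *ₚ r) k ≈ a * coeff r k + coeff (0# ∷ (p *ₚ r)) k
    coeff-* a p r k = trans (coeff-+ (map (a *_) r) _ k) (+-congʳ (coeff-scale a r k))

    *-#0⇒right : ∀ p r k → coeff (p *ₚ r) k # 0# → ∃[ l ] (l ≤ k × coeff r l # 0#)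
    *-#0⇒right []      r k h = 0#0⇒ h
    *-#0⇒right (a ∷ p) r k h with x+y#0⇒ (#-congʳ (coeff-* a p r k) h)
    *-#0⇒right (a ∷ p) r k       h | inj₁ u = k , ℕₚ.≤-refl , x*y#0⇒y#0 u
    *-#0⇒right (a ∷ p) r zero    h | inj₂ v = 0#0⇒ v
    *-#0⇒right (a ∷ p) r (suc k) h | inj₂ v with *-#0⇒right p r k v
    ... | l , l≤k , w = l , ℕₚ.m≤n⇒m≤1+n l≤k , w

    head-case : ∀ a p r j N → j ≤ N → a # 0# → coeff r j # 0# → Nonzeroₚ ((a ∷ p) *ₚ r)
    head-case a p r j N j≤N ha hr
      with x#0⇒ (coeff (0# ∷ (p *ₚ r)) j) (x#0y#0→xy#0 ha hr)
    ... | inj₁ u = j , #-congʳ (sym (coeff-* a p r j)) u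
    head-case a p r zero    N       j≤N       ha hr | inj₂ v = 0#0⇒ v
    head-case a p r (suc j) (suc N) (s≤s j≤N) ha hr | inj₂ v
      with *-#0⇒right p r j v
    ... | l , l≤j , w = head-case a p r l N (ℕₚ.≤-trans l≤j j≤N) ha w

  *ₚ-nonzero : ∀ {p r} → Nonzeroₚ p → Nonzeroₚ r → Nonzeroₚ (p *ₚ r)
  *ₚ-nonzero {[]}    {r} (i , hp) _ = 0#0⇒ hp
  *ₚ-nonzero {a ∷ p} {r} (zero , hp) (j , hr) = head-case a p r j j ℕₚ.≤-refl hp hr
  *ₚ-nonzero {a ∷ p} {r} (suc i , hp) (j , hr)
    with *ₚ-nonzero {p} {r} (i , hp) (j , hr)
  ... | k , h with x#0⇒ (a * coeff r (suc k)) h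
  ...   | inj₁ u = suc k ,
                   #-congʳ (trans (+-comm _ _) (sym (coeff-* a p r (suc k)))) u
  ...   | inj₂ v = head-case a p r j j ℕₚ.≤-refl (x*y#0⇒x#0 v) hr

-- Formal fractions of polynomials, up to cross-multiplication.

module RationalFunctions {c ℓ₁ ℓ₂} (F : HeytingField c ℓ₁ ℓ₂) where

  open HeytingField F using (Carrier; 0#; 1#; heytingCommutativeRing)
  open HeytingProperties heytingCommutativeRing using (1#0)
  open Polynomials F

  record F⟨q⟩ : Set (c ⊔ ℓ₂) where
    constructor frac
    field
      num         : Poly
      den         : Poly
      den-nonzero : Nonzeroₚ den

  open F⟨q⟩ public

  infix  4 _≈ᶠ_
  infixl 6 _+ᶠ_ _-ᶠ_
  infixl 7 _*ᶠ_
  infix  7 _/_⟨_⟩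

  _≈ᶠ_ : F⟨q⟩ → F⟨q⟩ → Set ℓ₁
  x ≈ᶠ y = num x *ₚ den y ≈ₚ num y *ₚ den x

  Nonzeroᶠ : F⟨q⟩ → Set ℓ₂
  Nonzeroᶠ x = Nonzeroₚ (num x)

  poly : Poly → F⟨q⟩
  poly p = frac p (1# ∷ []) (0 , 1#0)

  0ᶠ 1ᶠ q : F⟨q⟩
  0ᶠ = poly []
  1ᶠ = poly (1# ∷ [])
  q  = poly (0# ∷ 1# ∷ [])

  _+ᶠ_ _-ᶠ_ _*ᶠ_ : F⟨q⟩ → F⟨q⟩ → F⟨q⟩
  frac a b b≉0 +ᶠ frac c d d≉0 =
    frac (a *ₚ d +ₚ c *ₚ b) (b *ₚ d) (*ₚ-nonzero {b} {d} b≉0 d≉0)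
  x -ᶠ frac c d d≉0 = x +ᶠ frac (-ₚ c) d d≉0
  frac a b b≉0 *ᶠ frac c d d≉0 =
    frac (a *ₚ c) (b *ₚ d) (*ₚ-nonzero {b} {d} b≉0 d≉0)

  _/_⟨_⟩ : (x y : F⟨q⟩) → Nonzeroᶠ y → F⟨q⟩
  x / frac c d d≉0 ⟨ c≉0 ⟩ = x *ᶠ frac d c c≉0

  -- [ m ]q is the polynomial all of whose first m coefficients are 1.
  [_]q : ℕ → F⟨q⟩
  [ m ]q = poly (replicate m 1#)

  [_]q! : ℕ → F⟨q⟩
  [ zero  ]q! = 1ᶠ
  [ suc m ]q! = [ suc m ]q *ᶠ [ m ]q!

  *ᶠ-nonzero : ∀ {x y} → Nonzeroᶠ x → Nonzeroᶠ y → Nonzeroᶠ (x *ᶠ y)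
  *ᶠ-nonzero {x} {y} = *ₚ-nonzero {num x} {num y}

  []q-nonzero : ∀ {m} → 1 ≤ m → Nonzeroᶠ [ m ]q
  []q-nonzero (s≤s _) = 0 , 1#0

  []q!-nonzero : ∀ m → Nonzeroᶠ [ m ]q!
  []q!-nonzero zero    = 0 , 1#0
  []q!-nonzero (suc m) =
    *ᶠ-nonzero {[ suc m ]q} {[ m ]q!} ([]q-nonzero {suc m} (s≤s z≤n)) ([]q!-nonzero m)

  -- Only meaningful for k ≤ m, because of the truncated subtraction.
  qBinomial : ℕ → ℕ → F⟨q⟩
  qBinomial m k = [ m ]q! / [ k ]q! *ᶠ [ m ∸ k ]q!
    ⟨ *ᶠ-nonzero {[ k ]q!} {[ m ∸ k ]q!} ([]q!-nonzero k) ([]q!-nonzero (m ∸ k)) ⟩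

-- The shifted staircase.  The bounds are irrelevant, so that cells with
-- the same coordinates are equal.

record Staircase (n : ℕ) : Set where
  constructor cell
  field
    row  : ℕ
    col  : ℕ
    .1≤row   : 1 ≤ row
    .row≤col : row ≤ col
    .col≤n   : col ≤ n

open Staircase public

module _ {n : ℕ} where

  infix 4 _≤P_ _≤P?_ _≟P_

  _≤P_ : Rel (Staircase n) _
  p ≤P p′ = row p ≤ row p′ × col p ≤ col p′

  _≤P?_ : ∀ p p′ → Dec (p ≤P p′)
  p ≤P? p′ = (row p ℕₚ.≤? row p′) ×-dec (col p ℕₚ.≤? col p′)

  _≟P_ : (p p′ : Staircase n) → Dec (p ≡ p′)
  p ≟P p′ = map′ (λ { (≡.refl , ≡.refl) → ≡.refl })
                 (λ { ≡.refl → ≡.refl , ≡.refl })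
                 ((row p ℕₚ.≟ row p′) ×-dec (col p ℕₚ.≟ col p′))

toCell : ∀ n → ℕ × ℕ → Maybe (Staircase n)
toCell n (i , j) with 1 ℕₚ.≤? i | i ℕₚ.≤? j | j ℕₚ.≤? n
... | yes a | yes b | yes c = just (cell i j a b c)
... | _     | _     | _     = nothing

cells : ∀ n → List (Staircase n)
cells n = mapMaybe (toCell n) (cartesianProduct (upTo (suc n)) (upTo (suc n)))

module _ {n : ℕ} where

  private
    coords : Staircase n → ℕ × ℕ
    coords p = row p , col p

    toCell-coords : ∀ p → toCell n (coords p) ≡ just p
    toCell-coords (cell i j a b c) with 1 ℕₚ.≤? i | i ℕₚ.≤? j | j ℕₚ.≤? n
    ... | yes _ | yes _ | yes _ = ≡.refl
    ... | yes _ | yes _ | no ¬c = contradiction-irr c ¬c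
    ... | yes _ | no ¬b | _     = contradiction-irr b ¬b
    ... | no ¬a | _     | _     = contradiction-irr a ¬a

    coords-toCell : ∀ x {p} → toCell n x ≡ just p → coords p ≡ x
    coords-toCell (i , j) eq with 1 ℕₚ.≤? i | i ℕₚ.≤? j | j ℕₚ.≤? n
    coords-toCell (i , j) ≡.refl | yes _ | yes _ | yes _ = ≡.refl

    ∈-mapMaybe : ∀ {x p} xs → x ∈ xs → toCell n x ≡ just p → p ∈ mapMaybe (toCell n) xs
    ∈-mapMaybe (x ∷ xs) (here ≡.refl) eq with toCell n x | eq
    ... | just _ | ≡.refl = here ≡.refl
    ∈-mapMaybe (y ∷ xs) (there m) eq with toCell n y
    ... | just _  = there (∈-mapMaybe xs m eq)
    ... | nothing = ∈-mapMaybe xs m eq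

    fresh : ∀ {x p} xs → toCell n x ≡ just p →
            All (x ≢_) xs → All (p ≢_) (mapMaybe (toCell n) xs)
    fresh []       eq []       = []
    fresh (y ∷ xs) eq (h ∷ hs) with toCell n y in eq′
    ... | nothing = fresh xs eq hs
    ... | just r  =
      (λ p≡r → h (≡.trans (≡.sym (coords-toCell _ eq))
                   (≡.trans (≡.cong coords p≡r) (coords-toCell _ eq′))))
      ∷ fresh xs eq hs

    mapMaybe-unique : ∀ {xs} → Unique xs → Unique (mapMaybe (toCell n) xs)
    mapMaybe-unique []                    = []
    mapMaybe-unique {x ∷ xs} (h ∷ u) with toCell n x in eq
    ... | nothing = mapMaybe-unique u
    ... | just p  = fresh xs eq h ∷ mapMaybe-unique u

  cells-complete : ∀ p → p ∈ cells n
  cells-complete p@(cell i j a b c) =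
    ∈-mapMaybe (cartesianProduct (upTo (suc n)) (upTo (suc n)))
      (∈-cartesianProduct⁺
        (∈-upTo⁺ (s≤s (ℕₚ.≤-trans (recompute-≤ b) (recompute-≤ c))))
        (∈-upTo⁺ (s≤s (recompute-≤ c))))
      (toCell-coords p)
    where
    recompute-≤ : ∀ {k m} → .(k ≤ m) → k ≤ m
    recompute-≤ {k} {m} = recompute (k ℕₚ.≤? m)

  cells-unique : Unique (cells n)
  cells-unique = mapMaybe-unique
    (UniqueProperties.cartesianProduct⁺
      (UniqueProperties.upTo⁺ (suc n)) (UniqueProperties.upTo⁺ (suc n)))

record OrderIdeal (n : ℕ) : Set where
  field
    member : Staircase n → Bool
    downClosed : ∀ {p p′} → p′ ≤P p → T (member p) → T (member p′)

infix 4 _∈I_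

_∈I_ : ∀ {n} → Staircase n → OrderIdeal n → Set
p ∈I I = T (OrderIdeal.member I p)

module _ {n : ℕ} where

  MinimalOutside MaximalInside : Staircase n → OrderIdeal n → Set
  MinimalOutside p I = ¬ p ∈I I × (∀ r → ¬ r ∈I I → r ≤P p → r ≡ p)
  MaximalInside  p I = p ∈I I × (∀ r → r ∈I I → p ≤P r → r ≡ p)

  private
    ∀P? : ∀ {ℓ} {Q : Staircase n → Set ℓ} → (∀ p → Dec (Q p)) → Dec (∀ p → Q p)
    ∀P? Q? = map′ (λ h p → lookup h (cells-complete p)) (λ h → tabulate (λ {p} _ → h p))
                  (all? Q? (cells n))

    _∈I?_ : ∀ p (I : OrderIdeal n) → Dec (p ∈I I)
    p ∈I? I = T? (OrderIdeal.member I p)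

  minimalOutside? : ∀ p I → Dec (MinimalOutside p I)
  minimalOutside? p I =
    ¬? (p ∈I? I) ×-dec ∀P? (λ r → ¬? (r ∈I? I) →-dec ((r ≤P? p) →-dec (r ≟P p)))

  maximalInside? : ∀ p I → Dec (MaximalInside p I)
  maximalInside? p I =
    (p ∈I? I) ×-dec ∀P? (λ r → (r ∈I? I) →-dec ((p ≤P? r) →-dec (r ≟P p)))

module Toggleability {c ℓ₁ ℓ₂} (F : HeytingField c ℓ₁ ℓ₂) (n : ℕ) where

  open RationalFunctions F

  Statistic : Set (c ⊔ ℓ₂)
  Statistic = OrderIdeal n → F⟨q⟩

  ∑P : (Staircase n → F⟨q⟩) → F⟨q⟩
  ∑P f = foldr _+ᶠ_ 0ᶠ (map f (cells n))

  indicator : ∀ {a} {A : Set a} → Dec A → F⟨q⟩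
  indicator d = if does d then 1ᶠ else 0ᶠ

  T⁺ T⁻ Tᵠ : Staircase n → Statistic
  T⁺ p I = indicator (minimalOutside? p I)
  T⁻ p I = indicator (maximalInside? p I)
  Tᵠ p I = T⁺ p I -ᶠ q *ᶠ T⁻ p I

  infix 4 _≡ᵠ_

  _≡ᵠ_ : Statistic → Statistic → Set (c ⊔ ℓ₁ ⊔ ℓ₂)
  f ≡ᵠ g = Σ[ a ∈ (Staircase n → F⟨q⟩) ]
             (∀ I → f I -ᶠ g I ≈ᶠ ∑P (λ p → a p *ᶠ Tᵠ p I))

  constant : F⟨q⟩ → Statistic
  constant x _ = x

1≤2*n : ∀ {n} → 1 ≤ n → 1 ≤ 2 ℕ.* n
1≤2*n {n} 1≤n = ℕₚ.≤-trans 1≤n (ℕₚ.m≤m+n n _)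

-- Let χ be the indicator function of an ideal I, extended by 1 to row 0 and
-- by 0 to the other places off the staircase.  Off the diagonal T⁻ and T⁺ are
-- quadratic in χ, and with coefficients of the form c = B(j) - A(i), where
-- A and B satisfy affine recursions with ratio q, the quadratic and linear
-- terms of T⁻ - c (T⁺ - q T⁻) form a discrete divergence.  So the sum over all
-- cells telescopes to a boundary sum along the diagonal and, for a suitable
-- choice of the coefficients there, that sum telescopes to a constant.  All the
-- conditions are met by A(i) = -[i-1]/(1+qⁿ), B(j) = ([j-1]-[n])/(1+qⁿ) and the
-- diagonal coefficients -A(i) - C with C = [n+1]/((1+q)(1+qⁿ)).

module Submission where

open import Defs
open import Algebra.Apartness.Bundles using (HeytingCommutativeRing; HeytingField)
open import Algebra.Bundles using (CommutativeRing; RawRing)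
import Algebra.Properties.Ring
import Algebra.Properties.Semiring.Mult.TCOptimised
import Algebra.Solver.Ring
open import Algebra.Solver.Ring.AlmostCommutativeRing using (fromCommutativeRing; _-Raw-AlmostCommutative⟶_)
import Algebra.Solver.Ring.NaturalCoefficients.Default
open import Data.Bool.Base using (Bool; true; false; T; _∧_; not; if_then_else_)
open import Data.Bool.Properties using (T?; ∧-identityʳ)
open import Data.List.Base using (List; []; _∷_; map; foldr; _++_; mapMaybe; applyUpTo; upTo; replicate;
  cartesianProduct)
open import Data.Maybe.Base using (Maybe; just; nothing; maybe′)
open import Data.Nat.Base as ℕ using (ℕ; zero; suc; _∸_; _≤_; _<_; z≤n; s≤s)
import Data.Nat.Properties as ℕₚ
open import Data.Product.Base using (_×_; _,_; proj₁; proj₂; ∃-syntax)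
open import Data.Unit.Base using (tt)
open import Function.Base using (_∘_; id)
open import Function.Bundles using (mk⇔)
open import Level using (Level; _⊔_)
open import Relation.Binary.Definitions using (tri<; tri≈; tri>)
open import Relation.Binary.PropositionalEquality as ≡ using (_≡_; cong; cong₂; subst)
import Relation.Binary.Reasoning.Setoid
open import Relation.Nullary using (¬_; Dec; yes; no; does; contradiction)
open import Relation.Nullary.Decidable using (does-⇔; dec-true; dec-false; decidable-stable; recompute; ¬?; _×-dec_)
open import Relation.Nullary.Negation using (contradiction-irr)

-- The term at a cell with coefficient c is `(1 + q c) T⁻ - c T⁺`. The quadratic part of `T⁻` at
-- (i,j) is χ(i,j+1) χ(i+1,j), which is also that of `T⁺` at (i+1,j+1). So the quadratic terms
-- cancel along diagonals when 1 + q c(i,j) = c(i+1,j+1). In the indices of the code, which start at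
-- 0, c = B(s) - A(r) turns this into A(r+1) = q A(r) - d and B(s+1) = q B(s) + 1 - d with one
-- common constant d. The linear terms balance because a difference of this kind satisfies c(r,s) +
-- c(r+1,s+1) = c(r,s+1) + c(r+1,s). Two boundary effects fix the rest. Where row 0, which lies in
-- every ideal, meets column n + 1, which lies outside it, a product survives with coefficient B(n)
-- - A(0); both values are normalised to 0. On the diagonal C has to be the same in every row, which
-- forces d = 1/(1+qⁿ) and then (1+q) C = d [n+1].

-- The ring solver with coefficients in ℤ, an integer being a formal
-- difference of natural numbers.
module IntegerCoefficients {c ℓ} (R : CommutativeRing c ℓ) where

  open CommutativeRing R
  open Algebra.Properties.Ring ring using (-‿+-comm; -‿distribˡ-*; -‿distribʳ-*; -‿involutive; -0#≈0#)
  open Algebra.Properties.Semiring.Mult.TCOptimised semiring renaming (_×_ to _·_) using (×-homo-+; ×1-homo-*)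
  open Relation.Binary.Reasoning.Setoid setoid
  private
    module S = Algebra.Solver.Ring.NaturalCoefficients.Default commutativeSemiring

    difference : RawRing _ _
    difference = record
      { Carrier = ℕ × ℕ
      ; _≈_     = _≡_
      ; _+_     = λ { (a , b) (c , d) → a ℕ.+ c , b ℕ.+ d }
      ; _*_     = λ { (a , b) (c , d) → a ℕ.* c ℕ.+ b ℕ.* d , a ℕ.* d ℕ.+ b ℕ.* c }
      ; -_      = λ { (a , b) → b , a }
      ; 0#      = 0 , 0
      ; 1#      = 1 , 0
      }

    -- The first clause makes the constants 0 and 1 evaluate to 0# and 1#.
    ⟦_⟧ : ℕ × ℕ → Carrier
    ⟦ a , zero  ⟧ = a · 1#
    ⟦ a , suc b ⟧ = a · 1# - suc b · 1#

    ⟦⟧-difference : ∀ a b → ⟦ a , b ⟧ ≈ a · 1# - b · 1#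
    ⟦⟧-difference a zero    = sym (trans (+-congˡ -0#≈0#) (+-identityʳ _))
    ⟦⟧-difference a (suc b) = refl

    +-difference : ∀ w x y z → (w + y) - (x + z) ≈ (w - x) + (y - z)
    +-difference w x y z = trans (+-congˡ (sym (-‿+-comm x z)))
      (S.solve 4 (λ w x y z → (w S.:+ y) S.:+ (x S.:+ z) S.:= (w S.:+ x) S.:+ (y S.:+ z))
        refl w (- x) y (- z))

    *-difference : ∀ w x y z → (w * y + x * z) - (w * z + x * y) ≈ (w - x) * (y - z)
    *-difference w x y z = begin
      (w * y + x * z) - (w * z + x * y)
        ≈⟨ +-cong (+-congˡ (sym (-‿involutive _))) (sym (-‿+-comm _ _)) ⟩
      (w * y - - (x * z)) + (- (w * z) - x * y)
        ≈⟨ +-cong (+-congˡ (trans (-‿cong (-‿distribˡ-* x z)) (-‿distribʳ-* (- x) z)))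
                  (+-cong (-‿distribʳ-* w z) (-‿distribˡ-* x y)) ⟩
      (w * y + - x * - z) + (w * - z + - x * y)
        ≈⟨ S.solve 4 (λ w x y z → (w S.:* y S.:+ x S.:* z) S.:+ (w S.:* z S.:+ x S.:* y)
             S.:= (w S.:+ x) S.:* (y S.:+ z)) refl w (- x) y (- z) ⟩
      (w - x) * (y - z) ∎

    morphism : difference -Raw-AlmostCommutative⟶ fromCommutativeRing R
    morphism = record
      { ⟦_⟧    = ⟦_⟧
      ; +-homo = λ { (a , b) (c , d) → begin
          ⟦ a ℕ.+ c , b ℕ.+ d ⟧                       ≈⟨ ⟦⟧-difference (a ℕ.+ c) (b ℕ.+ d) ⟩
          (a ℕ.+ c) · 1# - (b ℕ.+ d) · 1#             ≈⟨ +-cong (×-homo-+ 1# a c) (-‿cong (×-homo-+ 1# b d)) ⟩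
          (a · 1# + c · 1#) - (b · 1# + d · 1#)       ≈⟨ +-difference _ _ _ _ ⟩
          (a · 1# - b · 1#) + (c · 1# - d · 1#)       ≈⟨ +-cong (⟦⟧-difference a b) (⟦⟧-difference c d) ⟨
          ⟦ a , b ⟧ + ⟦ c , d ⟧ ∎ }
      ; *-homo = λ { (a , b) (c , d) → begin
          ⟦ a ℕ.* c ℕ.+ b ℕ.* d , a ℕ.* d ℕ.+ b ℕ.* c ⟧
            ≈⟨ ⟦⟧-difference (a ℕ.* c ℕ.+ b ℕ.* d) (a ℕ.* d ℕ.+ b ℕ.* c) ⟩
          (a ℕ.* c ℕ.+ b ℕ.* d) · 1# - (a ℕ.* d ℕ.+ b ℕ.* c) · 1#
            ≈⟨ +-cong (·-homo-*+* a c b d) (-‿cong (·-homo-*+* a d b c)) ⟩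
          (a · 1# * c · 1# + b · 1# * d · 1#) - (a · 1# * d · 1# + b · 1# * c · 1#)
            ≈⟨ *-difference _ _ _ _ ⟩
          (a · 1# - b · 1#) * (c · 1# - d · 1#)
            ≈⟨ *-cong (⟦⟧-difference a b) (⟦⟧-difference c d) ⟨
          ⟦ a , b ⟧ * ⟦ c , d ⟧ ∎ }
      ; -‿homo = λ { (a , b) → begin
          ⟦ b , a ⟧              ≈⟨ ⟦⟧-difference b a ⟩
          b · 1# - a · 1#        ≈⟨ +-comm _ _ ⟩
          - (a · 1#) + b · 1#    ≈⟨ +-congˡ (-‿involutive _) ⟨
          - (a · 1#) - - (b · 1#) ≈⟨ -‿+-comm _ _ ⟩
          - (a · 1# - b · 1#)    ≈⟨ -‿cong (⟦⟧-difference a b) ⟨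
          - ⟦ a , b ⟧ ∎ }
      ; 0-homo = refl
      ; 1-homo = refl
      }
      where
      ·-homo-*+* : ∀ a b c d → (a ℕ.* b ℕ.+ c ℕ.* d) · 1# ≈ a · 1# * b · 1# + c · 1# * d · 1#
      ·-homo-*+* a b c d = trans (×-homo-+ 1# (a ℕ.* b) (c ℕ.* d)) (+-cong (×1-homo-* a b) (×1-homo-* c d))

    -- Equal integers are recognised by a + d = c + b. A negative answer is `nothing` and not a
    -- refutation, since different integers may agree in a ring of positive characteristic.
    difference-≟ : ∀ x y → Maybe (⟦ x ⟧ ≈ ⟦ y ⟧)
    difference-≟ (a , b) (c , d) with a ℕ.+ d ℕₚ.≟ c ℕ.+ b
    ... | no _  = nothing
    ... | yes e = just (begin
      ⟦ a , b ⟧                              ≈⟨ ⟦⟧-difference a b ⟩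
      a · 1# - b · 1#                        ≈⟨ add-cancel _ _ _ ⟨
      (a · 1# + d · 1#) - (b · 1# + d · 1#)  ≈⟨ +-cong a+d≈c+b (-‿cong (+-comm _ _)) ⟩
      (c · 1# + b · 1#) - (d · 1# + b · 1#)  ≈⟨ add-cancel _ _ _ ⟩
      c · 1# - d · 1#                        ≈⟨ ⟦⟧-difference c d ⟨
      ⟦ c , d ⟧ ∎)
      where
      a+d≈c+b : a · 1# + d · 1# ≈ c · 1# + b · 1#
      a+d≈c+b = trans (sym (×-homo-+ 1# a d))
        (trans (reflexive (≡.cong (_· 1#) e)) (×-homo-+ 1# c b))
      add-cancel : ∀ x y z → (x + z) - (y + z) ≈ x - y
      add-cancel x y z = trans (+-difference x y z z) (trans (+-congˡ (-‿inverseʳ z)) (+-identityʳ _))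

  open Algebra.Solver.Ring difference (fromCommutativeRing R) morphism difference-≟ public
    using (solve; _:=_; _:+_; _:*_; _:-_; :-_; con)

  :0 :1 : ∀ {n} → Algebra.Solver.Ring.Polynomial difference (fromCommutativeRing R) morphism difference-≟ n
  :0 = con (0 , 0)
  :1 = con (1 , 0)

-- Polynomials and rational functions as commutative rings.

cancelʳ : ∀ {c ℓ} (R : CommutativeRing c ℓ) → let open CommutativeRing R in
  ∀ d → (∀ x → x * d ≈ 0# → x ≈ 0#) → ∀ x y → x * d ≈ y * d → x ≈ y
cancelʳ R d no-zero-divisors x y xd≈yd = +-cancelʳ (- y) x y (begin
  x - y   ≈⟨ no-zero-divisors (x - y) [x-y]d≈0 ⟩
  0#      ≈⟨ -‿inverseʳ y ⟨
  y - y   ∎)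
  where
  open CommutativeRing R
  open Algebra.Properties.Ring ring using (+-cancelʳ; [y-z]x≈yx-zx)
  open Relation.Binary.Reasoning.Setoid setoid
  [x-y]d≈0 : (x - y) * d ≈ 0#
  [x-y]d≈0 = begin
    (x - y) * d     ≈⟨ [y-z]x≈yx-zx d x y ⟩
    x * d - y * d   ≈⟨ +-congʳ xd≈yd ⟩
    y * d - y * d   ≈⟨ -‿inverseʳ (y * d) ⟩
    0#              ∎

module PolynomialRing {c ℓ₁ ℓ₂} (F : HeytingField c ℓ₁ ℓ₂) where

  open Polynomials F
  open HeytingField F using (heytingCommutativeRing; tight)
  private module H = HeytingCommutativeRing heytingCommutativeRing
  open CommutativeRing H.commutativeRing
  open Algebra.Properties.Ring ring using (-0#≈0#)
  open Algebra.Solver.Ring.NaturalCoefficients.Default commutativeSemiring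
  open Relation.Binary.Reasoning.Setoid setoid

  scale : Carrier → Poly → Poly
  scale a = map (a *_)

  shift : Poly → Poly
  shift p = 0# ∷ p

  coeff-+ : ∀ p r k → coeff (p +ₚ r) k ≈ coeff p k + coeff r k
  coeff-+ []      r       k       = sym (+-identityˡ _)
  coeff-+ (a ∷ p) []      k       = sym (+-identityʳ _)
  coeff-+ (a ∷ p) (b ∷ r) zero    = refl
  coeff-+ (a ∷ p) (b ∷ r) (suc k) = coeff-+ p r k

  coeff-scale : ∀ a p k → coeff (scale a p) k ≈ a * coeff p k
  coeff-scale a []      k       = sym (zeroʳ a)
  coeff-scale a (b ∷ p) zero    = refl
  coeff-scale a (b ∷ p) (suc k) = coeff-scale a p k

  coeff-neg : ∀ p k → coeff (-ₚ p) k ≈ - coeff p k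
  coeff-neg []      k       = sym -0#≈0#
  coeff-neg (a ∷ p) zero    = refl
  coeff-neg (a ∷ p) (suc k) = coeff-neg p k

  coeff-* : ∀ a p r k → coeff ((a ∷ p) *ₚ r) k ≈ a * coeff r k + coeff (shift (p *ₚ r)) k
  coeff-* a p r k = trans (coeff-+ (scale a r) _ k) (+-congʳ (coeff-scale a r k))

  shift-cong : ∀ {p r} → p ≈ₚ r → shift p ≈ₚ shift r
  shift-cong p≈r zero    = refl
  shift-cong p≈r (suc k) = p≈r k

  shift-+ : ∀ p r → shift (p +ₚ r) ≈ₚ shift p +ₚ shift r
  shift-+ p r zero    = sym (+-identityʳ 0#)
  shift-+ p r (suc k) = refl

  +ₚ-cong : ∀ {p p′ r r′} → p ≈ₚ p′ → r ≈ₚ r′ → p +ₚ r ≈ₚ p′ +ₚ r′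
  +ₚ-cong {p} {p′} {r} {r′} e f k =
    trans (coeff-+ p r k) (trans (+-cong (e k) (f k)) (sym (coeff-+ p′ r′ k)))

  +ₚ-assoc : ∀ p r s → (p +ₚ r) +ₚ s ≈ₚ p +ₚ (r +ₚ s)
  +ₚ-assoc p r s k = begin
    coeff ((p +ₚ r) +ₚ s) k                ≈⟨ trans (coeff-+ (p +ₚ r) s k) (+-congʳ (coeff-+ p r k)) ⟩
    (coeff p k + coeff r k) + coeff s k    ≈⟨ +-assoc _ _ _ ⟩
    coeff p k + (coeff r k + coeff s k)    ≈⟨ trans (coeff-+ p (r +ₚ s) k) (+-congˡ (coeff-+ r s k)) ⟨
    coeff (p +ₚ (r +ₚ s)) k                ∎

  +ₚ-comm : ∀ p r → p +ₚ r ≈ₚ r +ₚ p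
  +ₚ-comm p r k = trans (coeff-+ p r k) (trans (+-comm _ _) (sym (coeff-+ r p k)))

  +ₚ-identityʳ : ∀ p → p +ₚ [] ≈ₚ p
  +ₚ-identityʳ p k = trans (coeff-+ p [] k) (+-identityʳ _)

  -ₚ-inverseʳ : ∀ p → p +ₚ -ₚ p ≈ₚ []
  -ₚ-inverseʳ p k = trans (coeff-+ p (-ₚ p) k) (trans (+-congˡ (coeff-neg p k)) (-‿inverseʳ _))

  -ₚ-cong : ∀ {p r} → p ≈ₚ r → -ₚ p ≈ₚ -ₚ r
  -ₚ-cong {p} {r} e k = trans (coeff-neg p k) (trans (-‿cong (e k)) (sym (coeff-neg r k)))

  *ₚ-congˡ : ∀ p {r s} → r ≈ₚ s → p *ₚ r ≈ₚ p *ₚ s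
  *ₚ-congˡ []              e k = refl
  *ₚ-congˡ (a ∷ p) {r} {s} e k = begin
    coeff ((a ∷ p) *ₚ r) k                     ≈⟨ coeff-* a p r k ⟩
    a * coeff r k + coeff (shift (p *ₚ r)) k   ≈⟨ +-cong (*-congˡ (e k)) (shift-cong (*ₚ-congˡ p e) k) ⟩
    a * coeff s k + coeff (shift (p *ₚ s)) k   ≈⟨ coeff-* a p s k ⟨
    coeff ((a ∷ p) *ₚ s) k                     ∎

  *ₚ-zeroʳ : ∀ p → p *ₚ [] ≈ₚ []
  *ₚ-zeroʳ []      k       = refl
  *ₚ-zeroʳ (a ∷ p) zero    = refl
  *ₚ-zeroʳ (a ∷ p) (suc k) = *ₚ-zeroʳ p k

  -- The mirror image of `coeff-*`: multiplication recurses on its left factor only, and this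
  -- recursion on the right factor makes commutativity a plain induction.
  coeff-*-∷ʳ : ∀ p b r k → coeff (p *ₚ (b ∷ r)) k ≈ b * coeff p k + coeff (shift (p *ₚ r)) k
  coeff-*-∷ʳ [] b r zero = sym (trans (+-identityʳ _) (zeroʳ b))
  coeff-*-∷ʳ [] b r (suc k) = sym (trans (+-identityʳ _) (zeroʳ b))
  coeff-*-∷ʳ (a ∷ p) b r zero = +-congʳ (*-comm a b)
  coeff-*-∷ʳ (a ∷ p) b r (suc k) = begin
    coeff ((a ∷ p) *ₚ (b ∷ r)) (suc k)
      ≈⟨ coeff-* a p (b ∷ r) (suc k) ⟩
    a * coeff r k + coeff (p *ₚ (b ∷ r)) k
      ≈⟨ +-congˡ (coeff-*-∷ʳ p b r k) ⟩
    a * coeff r k + (b * coeff p k + coeff (shift (p *ₚ r)) k)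
      ≈⟨ solve 3 (λ x y z → x :+ (y :+ z) := y :+ (x :+ z)) refl _ _ _ ⟩
    b * coeff p k + (a * coeff r k + coeff (shift (p *ₚ r)) k)
      ≈⟨ +-congˡ (coeff-* a p r k) ⟨
    b * coeff p k + coeff ((a ∷ p) *ₚ r) k ∎

  *ₚ-comm : ∀ p r → p *ₚ r ≈ₚ r *ₚ p
  *ₚ-comm []      r k = sym (*ₚ-zeroʳ r k)
  *ₚ-comm (a ∷ p) r k = begin
    coeff ((a ∷ p) *ₚ r) k                     ≈⟨ coeff-* a p r k ⟩
    a * coeff r k + coeff (shift (p *ₚ r)) k   ≈⟨ +-congˡ (shift-cong (*ₚ-comm p r) k) ⟩
    a * coeff r k + coeff (shift (r *ₚ p)) k   ≈⟨ coeff-*-∷ʳ r a p k ⟨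
    coeff (r *ₚ (a ∷ p)) k                     ∎

  *ₚ-congʳ : ∀ {p p′} r → p ≈ₚ p′ → p *ₚ r ≈ₚ p′ *ₚ r
  *ₚ-congʳ {p} {p′} r e k = trans (*ₚ-comm p r k) (trans (*ₚ-congˡ r e k) (*ₚ-comm r p′ k))

  *ₚ-distribˡ : ∀ p r s → p *ₚ (r +ₚ s) ≈ₚ p *ₚ r +ₚ p *ₚ s
  *ₚ-distribˡ []      r s k = refl
  *ₚ-distribˡ (a ∷ p) r s k = begin
    coeff ((a ∷ p) *ₚ (r +ₚ s)) k
      ≈⟨ coeff-* a p (r +ₚ s) k ⟩
    a * coeff (r +ₚ s) k + coeff (shift (p *ₚ (r +ₚ s))) k
      ≈⟨ +-cong (*-congˡ (coeff-+ r s k))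
           (trans (shift-cong (*ₚ-distribˡ p r s) k)
             (trans (shift-+ (p *ₚ r) (p *ₚ s) k) (coeff-+ (shift (p *ₚ r)) (shift (p *ₚ s)) k))) ⟩
    a * (coeff r k + coeff s k) + (coeff (shift (p *ₚ r)) k + coeff (shift (p *ₚ s)) k)
      ≈⟨ solve 5 (λ a x y u v → a :* (x :+ y) :+ (u :+ v) := (a :* x :+ u) :+ (a :* y :+ v))
           refl a _ _ _ _ ⟩
    (a * coeff r k + coeff (shift (p *ₚ r)) k) + (a * coeff s k + coeff (shift (p *ₚ s)) k)
      ≈⟨ +-cong (coeff-* a p r k) (coeff-* a p s k) ⟨
    coeff ((a ∷ p) *ₚ r) k + coeff ((a ∷ p) *ₚ s) k
      ≈⟨ coeff-+ ((a ∷ p) *ₚ r) ((a ∷ p) *ₚ s) k ⟨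
    coeff ((a ∷ p) *ₚ r +ₚ (a ∷ p) *ₚ s) k ∎

  *ₚ-distribʳ : ∀ p r s → (r +ₚ s) *ₚ p ≈ₚ r *ₚ p +ₚ s *ₚ p
  *ₚ-distribʳ p r s k = trans (*ₚ-comm (r +ₚ s) p k) (trans (*ₚ-distribˡ p r s k)
    (+ₚ-cong {p *ₚ r} {r *ₚ p} {p *ₚ s} {s *ₚ p} (*ₚ-comm p r) (*ₚ-comm p s) k))

  scale-* : ∀ a p r → scale a p *ₚ r ≈ₚ scale a (p *ₚ r)
  scale-* a []      r k = refl
  scale-* a (b ∷ p) r k = begin
    coeff (scale a (b ∷ p) *ₚ r) k
      ≈⟨ coeff-* (a * b) (scale a p) r k ⟩
    a * b * coeff r k + coeff (shift (scale a p *ₚ r)) k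
      ≈⟨ +-congˡ (trans (shift-cong (scale-* a p r) k) (shift-scale k)) ⟩
    a * b * coeff r k + a * coeff (shift (p *ₚ r)) k
      ≈⟨ solve 4 (λ a b x y → a :* b :* x :+ a :* y := a :* (b :* x :+ y)) refl a b _ _ ⟩
    a * (b * coeff r k + coeff (shift (p *ₚ r)) k)
      ≈⟨ *-congˡ (coeff-* b p r k) ⟨
    a * coeff ((b ∷ p) *ₚ r) k
      ≈⟨ coeff-scale a ((b ∷ p) *ₚ r) k ⟨
    coeff (scale a ((b ∷ p) *ₚ r)) k ∎
    where
    shift-scale : ∀ k → coeff (shift (scale a (p *ₚ r))) k ≈ a * coeff (shift (p *ₚ r)) k
    shift-scale zero    = sym (zeroʳ a)
    shift-scale (suc k) = coeff-scale a (p *ₚ r) k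

  shift-* : ∀ p r → shift p *ₚ r ≈ₚ shift (p *ₚ r)
  shift-* p r k = trans (coeff-* 0# p r k) (trans (+-congʳ (zeroˡ _)) (+-identityˡ _))

  *ₚ-assoc : ∀ p r s → (p *ₚ r) *ₚ s ≈ₚ p *ₚ (r *ₚ s)
  *ₚ-assoc []      r s k = refl
  *ₚ-assoc (a ∷ p) r s k = begin
    coeff ((scale a r +ₚ shift (p *ₚ r)) *ₚ s) k
      ≈⟨ trans (*ₚ-distribʳ s (scale a r) (shift (p *ₚ r)) k) (coeff-+ (scale a r *ₚ s) _ k) ⟩
    coeff (scale a r *ₚ s) k + coeff (shift (p *ₚ r) *ₚ s) k
      ≈⟨ +-cong (scale-* a r s k)
           (trans (shift-* (p *ₚ r) s k) (shift-cong (*ₚ-assoc p r s) k)) ⟩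
    coeff (scale a (r *ₚ s)) k + coeff (shift (p *ₚ (r *ₚ s))) k
      ≈⟨ coeff-+ (scale a (r *ₚ s)) _ k ⟨
    coeff ((a ∷ p) *ₚ (r *ₚ s)) k ∎

  1ₚ : Poly
  1ₚ = 1# ∷ []

  shift-[] : shift [] ≈ₚ []
  shift-[] zero    = refl
  shift-[] (suc k) = refl

  *ₚ-identityˡ : ∀ p → 1ₚ *ₚ p ≈ₚ p
  *ₚ-identityˡ p k = trans (coeff-* 1# [] p k)
    (trans (+-cong (*-identityˡ _) (shift-[] k)) (+-identityʳ _))

  polynomialRing : CommutativeRing c ℓ₁
  polynomialRing = record
    { Carrier = Poly ; _≈_ = _≈ₚ_ ; _+_ = _+ₚ_ ; _*_ = _*ₚ_ ; -_ = -ₚ_ ; 0# = [] ; 1# = 1ₚ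
    ; isCommutativeRing = record
      { isRing = record
        { +-isAbelianGroup = record
          { isGroup = record
            { isMonoid = record
              { isSemigroup = record
                { isMagma = record
                  { isEquivalence = record
                    { refl  = λ k → refl
                    ; sym   = λ e k → sym (e k)
                    ; trans = λ e f k → trans (e k) (f k)
                    }
                  ; ∙-cong = λ {p} {p′} {r} {r′} → +ₚ-cong {p} {p′} {r} {r′}
                  }
                ; assoc = +ₚ-assoc
                }
              ; identity = (λ p k → refl) , +ₚ-identityʳ
              }
            ; inverse = (λ p k → trans (+ₚ-comm (-ₚ p) p k) (-ₚ-inverseʳ p k)) , -ₚ-inverseʳ
            ; ⁻¹-cong = λ {p} {r} → -ₚ-cong {p} {r}
            }
          ; comm = +ₚ-comm
          }
        ; *-cong = λ {p} {p′} {r} {r′} e f k → trans (*ₚ-congʳ {p} {p′} r e k) (*ₚ-congˡ p′ f k)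
        ; *-assoc = *ₚ-assoc
        ; *-identity = *ₚ-identityˡ , (λ p k → trans (*ₚ-comm p 1ₚ k) (*ₚ-identityˡ p k))
        ; distrib = *ₚ-distribˡ , *ₚ-distribʳ
        }
      ; *-comm = *ₚ-comm
      }
    }

  -- By tightness of the apartness it is enough to refute that a coefficient of `p` is apart from 0;
  -- such a coefficient would make some coefficient of the product apart from 0.
  *ₚ-no-zero-divisors : ∀ p {r} → Nonzeroₚ r → p *ₚ r ≈ₚ [] → p ≈ₚ []
  *ₚ-no-zero-divisors p {r} r≉0 pr≈0 k = proj₁ (tight _ _) λ pₖ#0 →
    let l , prₗ#0 = *ₚ-nonzero {p} {r} (k , pₖ#0) r≉0
    in proj₂ (tight _ _) (pr≈0 l) prₗ#0

  *ₚ-cancelʳ : ∀ p r d → Nonzeroₚ d → p *ₚ d ≈ₚ r *ₚ d → p ≈ₚ r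
  *ₚ-cancelʳ p r d d≉0 =
    cancelʳ polynomialRing d (λ p → *ₚ-no-zero-divisors p d≉0) p r

-- The laws of fractions a / b, equality being equality of cross products.
module CrossMultiplication {c ℓ} (R : CommutativeRing c ℓ) where

  open CommutativeRing R
  open IntegerCoefficients R
  open Algebra.Properties.Ring ring using (-‿distribˡ-*)
  open Relation.Binary.Reasoning.Setoid setoid

  /-trans : ∀ a b c d e f → (∀ x y → x * d ≈ y * d → x ≈ y) →
            a * d ≈ c * b → c * f ≈ e * d → a * f ≈ e * b
  /-trans a b c d e f cancel ad≈cb cf≈ed = cancel (a * f) (e * b) (begin
    a * f * d     ≈⟨ swap a f d ⟩
    a * d * f     ≈⟨ *-congʳ ad≈cb ⟩
    c * b * f     ≈⟨ swap c b f ⟩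
    c * f * b     ≈⟨ *-congʳ cf≈ed ⟩
    e * d * b     ≈⟨ swap e d b ⟩
    e * b * d     ∎)
    where
    swap : ∀ x y z → x * y * z ≈ x * z * y
    swap = solve 3 (λ x y z → x :* y :* z := x :* z :* y) refl

  /-+-cong : ∀ a b c d a′ b′ c′ d′ → a * d ≈ c * b → a′ * d′ ≈ c′ * b′ →
             (a * b′ + a′ * b) * (d * d′) ≈ (c * d′ + c′ * d) * (b * b′)
  /-+-cong a b c d a′ b′ c′ d′ e e′ = begin
    (a * b′ + a′ * b) * (d * d′)                ≈⟨ lhs a b d a′ b′ d′ ⟩
    (a * d) * (b′ * d′) + (a′ * d′) * (b * d)   ≈⟨ +-cong (*-congʳ e) (*-congʳ e′) ⟩
    (c * b) * (b′ * d′) + (c′ * b′) * (b * d)   ≈⟨ rhs b c d b′ c′ d′ ⟩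
    (c * d′ + c′ * d) * (b * b′)                ∎
    where
    lhs : ∀ a b d a′ b′ d′ →
          (a * b′ + a′ * b) * (d * d′) ≈ (a * d) * (b′ * d′) + (a′ * d′) * (b * d)
    lhs = solve 6 (λ a b d a′ b′ d′ → (a :* b′ :+ a′ :* b) :* (d :* d′)
      := (a :* d) :* (b′ :* d′) :+ (a′ :* d′) :* (b :* d)) refl
    rhs : ∀ b c d b′ c′ d′ →
          (c * b) * (b′ * d′) + (c′ * b′) * (b * d) ≈ (c * d′ + c′ * d) * (b * b′)
    rhs = solve 6 (λ b c d b′ c′ d′ → (c :* b) :* (b′ :* d′) :+ (c′ :* b′) :* (b :* d)
      := (c :* d′ :+ c′ :* d) :* (b :* b′)) refl

  /-*-cong : ∀ a b c d a′ b′ c′ d′ → a * d ≈ c * b → a′ * d′ ≈ c′ * b′ →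
             (a * a′) * (d * d′) ≈ (c * c′) * (b * b′)
  /-*-cong a b c d a′ b′ c′ d′ e e′ = begin
    (a * a′) * (d * d′)   ≈⟨ swap a a′ d d′ ⟩
    (a * d) * (a′ * d′)   ≈⟨ *-cong e e′ ⟩
    (c * b) * (c′ * b′)   ≈⟨ swap c b c′ b′ ⟩
    (c * c′) * (b * b′)   ∎
    where
    swap : ∀ w x y z → (w * x) * (y * z) ≈ (w * y) * (x * z)
    swap = solve 4 (λ w x y z → (w :* x) :* (y :* z) := (w :* y) :* (x :* z)) refl

  /-neg-cong : ∀ a b c d → a * d ≈ c * b → - a * d ≈ - c * b
  /-neg-cong a b c d e =
    trans (sym (-‿distribˡ-* a d)) (trans (-‿cong e) (-‿distribˡ-* c b))

  /-+-assoc : ∀ a b c d e f →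
    ((a * d + c * b) * f + e * (b * d)) * (b * (d * f)) ≈
    (a * (d * f) + (c * f + e * d) * b) * ((b * d) * f)
  /-+-assoc = solve 6 (λ a b c d e f →
    ((a :* d :+ c :* b) :* f :+ e :* (b :* d)) :* (b :* (d :* f)) :=
    (a :* (d :* f) :+ (c :* f :+ e :* d) :* b) :* ((b :* d) :* f)) refl

  /-+-comm : ∀ a b c d → (a * d + c * b) * (d * b) ≈ (c * b + a * d) * (b * d)
  /-+-comm = solve 4 (λ a b c d →
    (a :* d :+ c :* b) :* (d :* b) := (c :* b :+ a :* d) :* (b :* d)) refl

  /-+-identityˡ : ∀ a b → (0# * b + a * 1#) * b ≈ a * (1# * b)
  /-+-identityˡ = solve 2 (λ a b → (:0 :* b :+ a :* :1) :* b := a :* (:1 :* b)) refl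

  /-+-identityʳ : ∀ a b → (a * 1# + 0# * b) * b ≈ a * (b * 1#)
  /-+-identityʳ = solve 2 (λ a b → (a :* :1 :+ :0 :* b) :* b := a :* (b :* :1)) refl

  /-inverseʳ : ∀ a b → (a * b + - a * b) * 1# ≈ 0# * (b * b)
  /-inverseʳ = solve 2 (λ a b → (a :* b :+ :- a :* b) :* :1 := :0 :* (b :* b)) refl

  /-*-identityʳ : ∀ a b → (a * 1#) * b ≈ a * (b * 1#)
  /-*-identityʳ = solve 2 (λ a b → (a :* :1) :* b := a :* (b :* :1)) refl

  /-distribʳ : ∀ a b c d e f →
    ((c * f + e * d) * a) * ((d * b) * (f * b)) ≈
    ((c * a) * (f * b) + (e * a) * (d * b)) * ((d * f) * b)
  /-distribʳ = solve 6 (λ a b c d e f →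
    ((c :* f :+ e :* d) :* a) :* ((d :* b) :* (f :* b)) :=
    ((c :* a) :* (f :* b) :+ (e :* a) :* (d :* b)) :* ((d :* f) :* b)) refl

  /-inverseˡ : ∀ a b → (- a * b + a * b) * 1# ≈ 0# * (b * b)
  /-inverseˡ = solve 2 (λ a b → (:- a :* b :+ a :* b) :* :1 := :0 :* (b :* b)) refl

  /-*-assoc : ∀ a b c d e f →
    (a * c * e) * (b * (d * f)) ≈ (a * (c * e)) * (b * d * f)
  /-*-assoc = solve 6 (λ a b c d e f →
    (a :* c :* e) :* (b :* (d :* f)) := (a :* (c :* e)) :* (b :* d :* f)) refl

  /-*-comm : ∀ a b c d → (a * c) * (d * b) ≈ (c * a) * (b * d)
  /-*-comm = solve 4 (λ a b c d → (a :* c) :* (d :* b) := (c :* a) :* (b :* d)) refl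

  /-*-identityˡ : ∀ a b → (1# * a) * b ≈ a * (1# * b)
  /-*-identityˡ = solve 2 (λ a b → (:1 :* a) :* b := a :* (:1 :* b)) refl

  /-distribˡ : ∀ a b c d e f →
    (a * (c * f + e * d)) * ((b * d) * (b * f)) ≈
    ((a * c) * (b * f) + (a * e) * (b * d)) * (b * (d * f))
  /-distribˡ = solve 6 (λ a b c d e f →
    (a :* (c :* f :+ e :* d)) :* ((b :* d) :* (b :* f)) :=
    ((a :* c) :* (b :* f) :+ (a :* e) :* (b :* d)) :* (b :* (d :* f))) refl

  /1-cong : ∀ a b → a ≈ b → a * 1# ≈ b * 1#
  /1-cong a b = *-congʳ

  /1-homo-+ : ∀ a b → (a + b) * (1# * 1#) ≈ (a * 1# + b * 1#) * 1#
  /1-homo-+ = solve 2 (λ a b → (a :+ b) :* (:1 :* :1) := (a :* :1 :+ b :* :1) :* :1) refl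

  /1-homo-* : ∀ a b → (a * b) * (1# * 1#) ≈ (a * b) * 1#
  /1-homo-* = solve 2 (λ a b → (a :* b) :* (:1 :* :1) := (a :* b) :* :1) refl

  /-inverse : ∀ a b → (a * b) * 1# ≈ 1# * (b * a)
  /-inverse = solve 2 (λ a b → (a :* b) :* :1 := :1 :* (b :* a)) refl

module RationalFunctionRing {c ℓ₁ ℓ₂} (F : HeytingField c ℓ₁ ℓ₂) where

  open Polynomials F
  open PolynomialRing F
  open RationalFunctions F
  open HeytingField F using (1#)
  open CrossMultiplication polynomialRing
  private module P = CommutativeRing polynomialRing

  -ᶠ_ : F⟨q⟩ → F⟨q⟩
  -ᶠ frac a b b≉0 = frac (-ₚ a) b b≉0

  -- Fractions are never reduced, so each law is a fact about numerators and denominators over an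
  -- abstract ring. Only transitivity goes further: the middle denominator has to be cancelled.
  rationalFunctionRing : CommutativeRing (c ⊔ ℓ₂) ℓ₁
  rationalFunctionRing = record
    { Carrier = F⟨q⟩ ; _≈_ = _≈ᶠ_ ; _+_ = _+ᶠ_ ; _*_ = _*ᶠ_ ; -_ = -ᶠ_ ; 0# = 0ᶠ ; 1# = 1ᶠ
    ; isCommutativeRing = record
      { isRing = record
        { +-isAbelianGroup = record
          { isGroup = record
            { isMonoid = record
              { isSemigroup = record
                { isMagma = record
                  { isEquivalence = record
                    { refl  = λ {x} → P.refl {num x *ₚ den x}
                    ; sym   = λ {x} {y} → P.sym {num x *ₚ den y} {num y *ₚ den x}
                    ; trans = λ { {frac a b _} {frac c d d≉0} {frac e f _} →
                        /-trans a b c d e f (λ x y → *ₚ-cancelʳ x y d d≉0) }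
                    }
                  ; ∙-cong = λ { {frac a b _} {frac c d _} {frac a′ b′ _} {frac c′ d′ _} →
                      /-+-cong a b c d a′ b′ c′ d′ }
                  }
                ; assoc = λ { (frac a b _) (frac c d _) (frac e f _) → /-+-assoc a b c d e f }
                }
              ; identity = (λ { (frac a b _) → /-+-identityˡ a b }) , (λ { (frac a b _) → /-+-identityʳ a b })
              }
            ; inverse = (λ { (frac a b _) → /-inverseˡ a b }) , (λ { (frac a b _) → /-inverseʳ a b })
            ; ⁻¹-cong = λ { {frac a b _} {frac c d _} → /-neg-cong a b c d }
            }
          ; comm = λ { (frac a b _) (frac c d _) → /-+-comm a b c d }
          }
        ; *-cong = λ { {frac a b _} {frac c d _} {frac a′ b′ _} {frac c′ d′ _} →
                      /-*-cong a b c d a′ b′ c′ d′ }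
        ; *-assoc = λ { (frac a b _) (frac c d _) (frac e f _) → /-*-assoc a b c d e f }
        ; *-identity = (λ { (frac a b _) → /-*-identityˡ a b }) , (λ { (frac a b _) → /-*-identityʳ a b })
        ; distrib = (λ { (frac a b _) (frac c d _) (frac e f _) → /-distribˡ a b c d e f })
                  , (λ { (frac a b _) (frac c d _) (frac e f _) → /-distribʳ a b c d e f })
        }
      ; *-comm = λ { (frac a b _) (frac c d _) → /-*-comm a b c d }
      }
    }

  poly-cong : ∀ p r → p ≈ₚ r → poly p ≈ᶠ poly r
  poly-cong = /1-cong

  poly-+ : ∀ p r → poly (p +ₚ r) ≈ᶠ poly p +ᶠ poly r
  poly-+ = /1-homo-+

  poly-* : ∀ p r → poly (p *ₚ r) ≈ᶠ poly p *ᶠ poly r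
  poly-* = /1-homo-*

  recip : ∀ x → Nonzeroᶠ x → F⟨q⟩
  recip (frac a b b≉0) a≉0 = frac b a a≉0

  recip-inverseʳ : ∀ x x≉0 → x *ᶠ recip x x≉0 ≈ᶠ 1ᶠ
  recip-inverseʳ (frac a b _) _ = /-inverse a b

  -- Dividing is multiplying by the swapped fraction, so both sides have the same numerator and
  -- denominator by computation.
  /-/ : ∀ x y z y≉0 z≉0 →
    (x / y ⟨ y≉0 ⟩) / z ⟨ z≉0 ⟩ ≈ᶠ x *ᶠ recip y y≉0 *ᶠ recip z z≉0
  /-/ x y z y≉0 z≉0 = P.refl {num (x *ᶠ recip y y≉0 *ᶠ recip z z≉0) *ₚ
                              den (x *ᶠ recip y y≉0 *ᶠ recip z z≉0)}

  []q-suc : ∀ m → [ suc m ]q ≈ᶠ 1ᶠ +ᶠ q *ᶠ [ m ]q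
  []q-suc m = begin
    poly (1# ∷ p)                       ≈⟨ poly-cong (1# ∷ p) (1ₚ +ₚ qₚ *ₚ p) 1∷p≈1+qp ⟩
    poly (1ₚ +ₚ qₚ *ₚ p)                ≈⟨ poly-+ 1ₚ (qₚ *ₚ p) ⟩
    1ᶠ +ᶠ poly (qₚ *ₚ p)                ≈⟨ R.+-congˡ {1ᶠ} {poly (qₚ *ₚ p)} {q *ᶠ poly p} (poly-* qₚ p) ⟩
    1ᶠ +ᶠ q *ᶠ poly p                   ∎
    where
    module R = CommutativeRing rationalFunctionRing
    open Relation.Binary.Reasoning.Setoid R.setoid
    p qₚ : Poly
    p = replicate m 1#
    qₚ = shift 1ₚ
    1∷p≈1+qp : 1# ∷ p ≈ₚ 1ₚ +ₚ qₚ *ₚ p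
    1∷p≈1+qp k = F.trans (1∷p k)
      (+ₚ-cong {1ₚ} {1ₚ} {shift p} {qₚ *ₚ p} (P.refl {1ₚ})
        (λ k → F.sym (F.trans (shift-* 1ₚ p k) (shift-cong (*ₚ-identityˡ p) k))) k)
      where
      module F = HeytingField F
      1∷p : 1# ∷ p ≈ₚ 1ₚ +ₚ shift p
      1∷p zero    = F.sym (F.+-identityʳ 1#)
      1∷p (suc k) = F.refl

-- Ideals as Boolean arrays, and toggleability read off from neighbouring entries.

≤-recompute : ∀ {k m} → .(k ≤ m) → k ≤ m
≤-recompute {k} {m} = recompute (k ℕₚ.≤? m)

toCell-cell : ∀ {n} (p : Staircase n) → toCell n (row p , col p) ≡ just p
toCell-cell {n} (cell i j a b c) with 1 ℕₚ.≤? i | i ℕₚ.≤? j | j ℕₚ.≤? n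
... | yes _ | yes _ | yes _ = ≡.refl
... | yes _ | yes _ | no ¬c = contradiction-irr c ¬c
... | yes _ | no ¬b | _     = contradiction-irr b ¬b
... | no ¬a | _     | _     = contradiction-irr a ¬a

toCell-below : ∀ {n i j} → j < i → toCell n (i , j) ≡ nothing
toCell-below {n} {i} {j} j<i with 1 ℕₚ.≤? i | i ℕₚ.≤? j
... | no _  | _       = ≡.refl
... | yes _ | no _    = ≡.refl
... | yes _ | yes i≤j = contradiction i≤j (ℕₚ.<⇒≱ j<i)

module _ {n : ℕ} (I : OrderIdeal n) where

  open OrderIdeal I

  -- Row 0 belongs to every ideal; other pairs off the staircase to none.
  isIn : ℕ → ℕ → Bool
  isIn zero    j = true
  isIn (suc r) j = maybe′ member false (toCell n (suc r , j))

  isIn-cell : ∀ p → isIn (row p) (col p) ≡ member p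
  isIn-cell (cell zero    j a b c) = contradiction-irr a λ ()
  isIn-cell p@(cell (suc r) j a b c) rewrite toCell-cell p = ≡.refl

  ∈I⇒isIn : ∀ p → p ∈I I → T (isIn (row p) (col p))
  ∈I⇒isIn p = subst T (≡.sym (isIn-cell p))

  isIn⇒∈I : ∀ p → T (isIn (row p) (col p)) → p ∈I I
  isIn⇒∈I p = subst T (isIn-cell p)

  isIn⇒cell : ∀ r j → T (isIn (suc r) j) → ∃[ p ] (row p ≡ suc r × col p ≡ j × p ∈I I)
  isIn⇒cell r j h with suc r ℕₚ.≤? j | j ℕₚ.≤? n
  ... | yes a | yes b = cell (suc r) j (s≤s z≤n) a b , ≡.refl , ≡.refl , h

  -- The condition `i′ ≤ j′` keeps the smaller pair on the staircase or in row 0: below the diagonal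
  -- the array is `false`, so monotonicity fails there.
  isIn-mono : ∀ {i i′ j j′} → i′ ≤ i → j′ ≤ j → i′ ≤ j′ → T (isIn i j) → T (isIn i′ j′)
  isIn-mono {i′ = zero} _ _ _ _ = tt
  isIn-mono {suc r} {suc r′} {j} {j′} i′≤i j′≤j i′≤j′ h with isIn⇒cell r j h
  ... | p@(cell _ _ _ _ j≤n) , ≡.refl , ≡.refl , p∈I =
    ∈I⇒isIn p′ (downClosed {p} {p′} (i′≤i , j′≤j) p∈I)
    where
    p′ : Staircase n
    p′ = cell (suc r′) j′ (s≤s z≤n) i′≤j′ (ℕₚ.≤-trans j′≤j (≤-recompute j≤n))

  isIn-beyond : ∀ {i j} → 1 ≤ i → n < j → isIn i j ≡ false
  isIn-beyond {suc r} {j} _ n<j with suc r ℕₚ.≤? j | j ℕₚ.≤? n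
  ... | no _  | _       = ≡.refl
  ... | yes _ | yes j≤n = contradiction j≤n (ℕₚ.<⇒≱ n<j)
  ... | yes _ | no _    = ≡.refl

  isIn-below : ∀ {r j} → j ≤ r → isIn (suc r) j ≡ false
  isIn-below {r} {j} j≤r rewrite toCell-below {n} {suc r} {j} (s≤s j≤r) = ≡.refl

  -- A member of `I` strictly above `p` has, by down-closure, one of the two upper neighbours of `p`
  -- below it and hence in `I`. A neighbour that is not a cell reads as `false` and imposes nothing.
  does-maximalInside : ∀ p → does (maximalInside? p I) ≡
    isIn (row p) (col p) ∧ not (isIn (row p) (suc (col p))) ∧ not (isIn (suc (row p)) (col p))
  does-maximalInside p@(cell i j 1≤i i≤j j≤n) = does-⇔ (mk⇔ to from) (maximalInside? p I)
    (T? (isIn i j) ×-dec ¬? (T? (isIn i (suc j))) ×-dec ¬? (T? (isIn (suc i) j)))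
    where
    to : MaximalInside p I → T (isIn i j) × ¬ T (isIn i (suc j)) × ¬ T (isIn (suc i) j)
    to (p∈I , max) = ∈I⇒isIn p p∈I , right , down
      where
      right : ¬ T (isIn i (suc j))
      right h with ≤-recompute 1≤i
      ... | s≤s _ with isIn⇒cell _ (suc j) h
      ...   | r , ≡.refl , ≡.refl , r∈I =
        contradiction (cong col (max r r∈I (ℕₚ.≤-refl , ℕₚ.n≤1+n j))) ℕₚ.1+n≢n
      down : ¬ T (isIn (suc i) j)
      down h with isIn⇒cell i j h
      ... | r , ≡.refl , ≡.refl , r∈I =
        contradiction (cong row (max r r∈I (ℕₚ.n≤1+n i , ℕₚ.≤-refl))) ℕₚ.1+n≢n
    from : T (isIn i j) × ¬ T (isIn i (suc j)) × ¬ T (isIn (suc i) j) → MaximalInside p I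
    from (h , right , down) = isIn⇒∈I p h , max
      where
      max : ∀ r → r ∈I I → p ≤P r → r ≡ p
      max r@(cell i′ j′ _ i′≤j′ _) r∈I (i≤i′ , j≤j′) with ℕₚ.<-cmp j j′ | ℕₚ.<-cmp i i′
      ... | tri< j<j′ _ _ | _ = contradiction
        (isIn-mono {i′} {i} i≤i′ j<j′ (ℕₚ.m≤n⇒m≤1+n (≤-recompute i≤j)) (∈I⇒isIn r r∈I)) right
      ... | tri> _ _ j′<j | _ = contradiction j≤j′ (ℕₚ.<⇒≱ j′<j)
      ... | tri≈ _ ≡.refl _ | tri< i<i′ _ _ = contradiction
        (isIn-mono {i′} {suc i} i<i′ j≤j′ (ℕₚ.≤-trans i<i′ (≤-recompute i′≤j′)) (∈I⇒isIn r r∈I)) down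
      ... | tri≈ _ ≡.refl _ | tri≈ _ ≡.refl _ = ≡.refl
      ... | tri≈ _ ≡.refl _ | tri> _ _ i′<i = contradiction i≤i′ (ℕₚ.<⇒≱ i′<i)

  -- Otherwise the neighbour in the row above would be a smaller cell outside `I`. In the first row
  -- the convention for row 0 gives the answer. Going up never leaves the staircase, so the diagonal
  -- needs no exception here, unlike for the left neighbour.
  minimalOutside⇒isIn-above : ∀ r {s} .(a : 1 ≤ suc r) .(b : suc r ≤ suc s) .(c : suc s ≤ n) →
    MinimalOutside (cell (suc r) (suc s) a b c) I → T (isIn r (suc s))
  minimalOutside⇒isIn-above zero    _ _ _ _ = tt
  minimalOutside⇒isIn-above (suc r) {s} _ b c (_ , min) = decidable-stable (T? _) λ h →
    contradiction (≡.sym (cong row (min u (h ∘ ∈I⇒isIn u) (ℕₚ.n≤1+n _ , ℕₚ.≤-refl)))) ℕₚ.1+n≢n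
    where
    u : Staircase n
    u = cell (suc r) (suc s) (s≤s z≤n) (ℕₚ.≤-trans (ℕₚ.n≤1+n _) b) c

  module _ {r s : ℕ} .(1≤ : 1 ≤ suc r) .(r≤s : suc r ≤ suc s) .(s<n : suc s ≤ n) where

    private
      p : Staircase n
      p = cell (suc r) (suc s) 1≤ r≤s s<n

      above : MinimalOutside p I → T (isIn r (suc s))
      above = minimalOutside⇒isIn-above r 1≤ r≤s s<n

      left : MinimalOutside p I → r < s → T (isIn (suc r) s)
      left (_ , min) r<s = decidable-stable (T? _) λ h →
        contradiction (≡.sym (cong col (min u (h ∘ ∈I⇒isIn u) (ℕₚ.≤-refl , ℕₚ.n≤1+n _)))) ℕₚ.1+n≢n
        where
        u : Staircase n
        u = cell (suc r) s 1≤ r<s (ℕₚ.≤-trans (ℕₚ.n≤1+n _) s<n)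

      minimal : ¬ T (isIn (suc r) (suc s)) → T (isIn r (suc s)) →
                (r < s → T (isIn (suc r) s)) → MinimalOutside p I
      minimal out above′ before = out ∘ ∈I⇒isIn p , min
        where
        min : ∀ u → ¬ u ∈I I → u ≤P p → u ≡ p
        min u@(cell i j _ i≤j _) u∉I (i≤ , j≤) with ℕₚ.<-cmp i (suc r) | ℕₚ.<-cmp j (suc s)
        ... | tri< i<r _ _ | _ = contradiction
          (isIn⇒∈I u (isIn-mono {r} {i} (ℕₚ.≤-pred i<r) j≤ (≤-recompute i≤j) above′)) u∉I
        ... | tri> _ _ r<i | _ = contradiction i≤ (ℕₚ.<⇒≱ r<i)
        -- A cell of the same row further left has column at least `suc r` and at most `s`, which
        -- supplies the `r < s` that `before` asks for; on the diagonal there is no such cell.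
        ... | tri≈ _ ≡.refl _ | tri< j<s _ _ = contradiction
          (isIn⇒∈I u (isIn-mono {suc r} {i} ℕₚ.≤-refl (ℕₚ.≤-pred j<s) (≤-recompute i≤j)
            (before (ℕₚ.≤-trans (≤-recompute i≤j) (ℕₚ.≤-pred j<s))))) u∉I
        ... | tri≈ _ ≡.refl _ | tri≈ _ ≡.refl _ = ≡.refl
        ... | tri≈ _ ≡.refl _ | tri> _ _ s<j = contradiction j≤ (ℕₚ.<⇒≱ s<j)

    does-minimalOutside-< : r < s → does (minimalOutside? p I) ≡
      not (isIn (suc r) (suc s)) ∧ isIn r (suc s) ∧ isIn (suc r) s
    does-minimalOutside-< r<s = does-⇔
      (mk⇔ (λ min → proj₁ min ∘ isIn⇒∈I p , above min , left min r<s)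
           (λ { (out , above′ , before) → minimal out above′ (λ _ → before) }))
      (minimalOutside? p I)
      (¬? (T? (isIn (suc r) (suc s))) ×-dec T? (isIn r (suc s)) ×-dec T? (isIn (suc r) s))

    does-minimalOutside-≡ : r ≡ s → does (minimalOutside? p I) ≡
      not (isIn (suc r) (suc s)) ∧ isIn r (suc s)
    does-minimalOutside-≡ r≡s = does-⇔
      (mk⇔ (λ min → proj₁ min ∘ isIn⇒∈I p , above min)
           (λ { (out , above′) → minimal out above′ (λ r<s → contradiction r≡s (ℕₚ.<⇒≢ r<s)) }))
      (minimalOutside? p I)
      (¬? (T? (isIn (suc r) (suc s))) ×-dec T? (isIn r (suc s)))

-- Finite sums and the algebra of indicators.

module _ {a p : Level} {A : Set a} {P : Set p} {x y : A} (P? : Dec P) where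

  if-yes : P → (if does P? then x else y) ≡ x
  if-yes h rewrite dec-true P? h = ≡.refl

  if-no : ¬ P → (if does P? then x else y) ≡ y
  if-no ¬h rewrite dec-false P? ¬h = ≡.refl

module Summation {c ℓ} (R : CommutativeRing c ℓ) where

  open CommutativeRing R
  open IntegerCoefficients R using (solve; _:=_; _:+_; _:-_; :-_; :0)
  open Relation.Binary.Reasoning.Setoid setoid

  ∑ : ∀ {a} {A : Set a} → List A → (A → Carrier) → Carrier
  ∑ xs f = foldr _+_ 0# (map f xs)

  ∑< : ℕ → (ℕ → Carrier) → Carrier
  ∑< zero    f = 0#
  ∑< (suc k) f = f 0 + ∑< k (f ∘ suc)

  ∑-cong : ∀ {a} {A : Set a} (xs : List A) {f g} → (∀ x → f x ≈ g x) → ∑ xs f ≈ ∑ xs g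
  ∑-cong []       e = refl
  ∑-cong (x ∷ xs) e = +-cong (e x) (∑-cong xs e)

  ∑-sub : ∀ {a} {A : Set a} (xs : List A) f g → ∑ xs (λ x → f x - g x) ≈ ∑ xs f - ∑ xs g
  ∑-sub []       f g = sym (-‿inverseʳ 0#)
  ∑-sub (x ∷ xs) f g = trans (+-congˡ (∑-sub xs f g))
    (solve 4 (λ a b c d → (a :- b) :+ (c :- d) := (a :+ c) :- (b :+ d)) refl _ _ _ _)

  ∑-++ : ∀ {a} {A : Set a} (xs ys : List A) f → ∑ (xs ++ ys) f ≈ ∑ xs f + ∑ ys f
  ∑-++ []       ys f = sym (+-identityˡ _)
  ∑-++ (x ∷ xs) ys f = trans (+-congˡ (∑-++ xs ys f)) (sym (+-assoc _ _ _))

  ∑-map : ∀ {a b} {A : Set a} {B : Set b} (h : A → B) xs f → ∑ (map h xs) f ≡ ∑ xs (f ∘ h)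
  ∑-map h []       f = ≡.refl
  ∑-map h (x ∷ xs) f = cong (f (h x) +_) (∑-map h xs f)

  ∑-mapMaybe : ∀ {a b} {A : Set a} {B : Set b} (h : A → Maybe B) xs f →
    ∑ (mapMaybe h xs) f ≈ ∑ xs (maybe′ f 0# ∘ h)
  ∑-mapMaybe h []       f = refl
  ∑-mapMaybe h (x ∷ xs) f with h x
  ... | just _  = +-congˡ (∑-mapMaybe h xs f)
  ... | nothing = trans (∑-mapMaybe h xs f) (sym (+-identityˡ _))

  ∑-cartesianProduct : ∀ {a b} {A : Set a} {B : Set b} (xs : List A) (ys : List B) f →
    ∑ (cartesianProduct xs ys) f ≈ ∑ xs (λ x → ∑ ys (λ y → f (x , y)))
  ∑-cartesianProduct []       ys f = refl
  ∑-cartesianProduct (x ∷ xs) ys f = trans (∑-++ (map (x ,_) ys) _ f)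
    (+-cong (reflexive (∑-map (x ,_) ys f)) (∑-cartesianProduct xs ys f))

  ∑-applyUpTo : ∀ {a} {A : Set a} (h : ℕ → A) k f → ∑ (applyUpTo h k) f ≡ ∑< k (f ∘ h)
  ∑-applyUpTo h zero    f = ≡.refl
  ∑-applyUpTo h (suc k) f = cong (f (h 0) +_) (∑-applyUpTo (h ∘ suc) k f)

  ∑<-cong : ∀ k {f g} → (∀ s → s < k → f s ≈ g s) → ∑< k f ≈ ∑< k g
  ∑<-cong zero    e = refl
  ∑<-cong (suc k) e = +-cong (e 0 (s≤s z≤n)) (∑<-cong k (λ s s<k → e (suc s) (s≤s s<k)))

  ∑<-zero : ∀ k {f} → (∀ s → s < k → f s ≈ 0#) → ∑< k f ≈ 0#
  ∑<-zero zero    e = refl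
  ∑<-zero (suc k) e = trans (+-cong (e 0 (s≤s z≤n)) (∑<-zero k (λ s s<k → e (suc s) (s≤s s<k))))
    (+-identityˡ 0#)

  -- One direction of a discrete divergence theorem: the horizontal part collapses to its ends,
  -- while the vertical part `u - v` becomes a difference of row sums, ready to telescope over the
  -- rows.
  ∑<-telescope : ∀ k (h u v : ℕ → Carrier) → ∑< k (λ s → (h (suc s) - h s) + (u s - v s)) ≈
                             (h k - h 0) + (∑< k u - ∑< k v)
  ∑<-telescope zero    h u v = sym (trans (+-cong (-‿inverseʳ (h 0)) (-‿inverseʳ 0#)) (+-identityˡ 0#))
  ∑<-telescope (suc k) h u v = trans (+-congˡ (∑<-telescope k (h ∘ suc) (u ∘ suc) (v ∘ suc)))
    (solve 7 (λ a b c d e f g → ((a :- b) :+ (c :- d)) :+ ((e :- a) :+ (f :- g)) :=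
       (e :- b) :+ ((c :+ f) :- (d :+ g))) refl _ _ _ _ _ _ _)

  ∑-cells : ∀ n f → ∑ (cells n) f ≈
    ∑< n (λ r → ∑< n (λ s → maybe′ f 0# (toCell n (suc r , suc s))))
  ∑-cells n f = begin
    ∑ (cells n) f
      ≈⟨ ∑-mapMaybe (toCell n) (cartesianProduct (upTo (suc n)) (upTo (suc n))) f ⟩
    ∑ (cartesianProduct (upTo (suc n)) (upTo (suc n))) g
      ≈⟨ ∑-cartesianProduct (upTo (suc n)) (upTo (suc n)) g ⟩
    ∑ (upTo (suc n)) (λ i → ∑ (upTo (suc n)) (λ j → g (i , j)))
      ≈⟨ ∑-cong (upTo (suc n)) (λ i → reflexive (∑-applyUpTo id (suc n) (λ j → g (i , j)))) ⟩
    ∑ (upTo (suc n)) (λ i → ∑< (suc n) (λ j → g (i , j)))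
      ≡⟨ ∑-applyUpTo id (suc n) (λ i → ∑< (suc n) (λ j → g (i , j))) ⟩
    ∑< (suc n) (λ i → ∑< (suc n) (λ j → g (i , j)))
      -- `toCell` computes to `nothing` on row 0 and on column 0, so both drop out. What is left is
      -- a full square, with zeros below the diagonal.
      ≈⟨ +-cong (∑<-zero (suc n) (λ _ _ → refl)) (∑<-cong n (λ r _ → +-identityˡ _)) ⟩
    0# + ∑< n (λ r → ∑< n (λ s → g (suc r , suc s)))
      ≈⟨ +-identityˡ _ ⟩
    ∑< n (λ r → ∑< n (λ s → g (suc r , suc s))) ∎
    where
    g : ℕ × ℕ → Carrier
    g = maybe′ f 0# ∘ toCell n

module Indicators {c ℓ} (R : CommutativeRing c ℓ) where

  open CommutativeRing R
  open IntegerCoefficients R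
  open Relation.Binary.Reasoning.Setoid setoid

  ⟦_⟧ : Bool → Carrier
  ⟦ b ⟧ = if b then 1# else 0#

  ⟦not⟧ : ∀ b → ⟦ not b ⟧ ≈ 1# - ⟦ b ⟧
  ⟦not⟧ true  = sym (-‿inverseʳ 1#)
  ⟦not⟧ false = solve 0 (:1 := :1 :- :0) refl

  ⟦∧⟧ : ∀ a b → ⟦ a ∧ b ⟧ ≈ ⟦ a ⟧ * ⟦ b ⟧
  ⟦∧⟧ true  b = sym (*-identityˡ ⟦ b ⟧)
  ⟦∧⟧ false b = sym (zeroˡ ⟦ b ⟧)

  -- The algebraic form of down-closure: it lowers the degree of products of indicators, and is why
  -- the toggles are at most quadratic in χ.
  absorb : ∀ a b → (T b → T a) → ⟦ a ⟧ * ⟦ b ⟧ ≈ ⟦ b ⟧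
  absorb true  b     _   = *-identityˡ ⟦ b ⟧
  absorb false false _   = zeroʳ 0#
  absorb false true  b⇒a with b⇒a tt
  ... | ()

  ⟦x∧¬y∧¬z⟧ : ∀ x y z → (T y → T x) → (T z → T x) →
    ⟦ x ∧ not y ∧ not z ⟧ ≈ ⟦ x ⟧ - ⟦ y ⟧ - ⟦ z ⟧ + ⟦ y ⟧ * ⟦ z ⟧
  ⟦x∧¬y∧¬z⟧ x y z y⇒x z⇒x = begin
    ⟦ x ∧ not y ∧ not z ⟧
      ≈⟨ trans (⟦∧⟧ x _) (*-congˡ (trans (⟦∧⟧ (not y) (not z)) (*-cong (⟦not⟧ y) (⟦not⟧ z)))) ⟩
    ⟦ x ⟧ * ((1# - ⟦ y ⟧) * (1# - ⟦ z ⟧))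
      ≈⟨ solve 3 (λ x y z → x :* ((:1 :- y) :* (:1 :- z)) :=
           x :- (x :* y) :- (x :* z) :+ (x :* y) :* z) refl _ _ _ ⟩
    ⟦ x ⟧ - ⟦ x ⟧ * ⟦ y ⟧ - ⟦ x ⟧ * ⟦ z ⟧ + ⟦ x ⟧ * ⟦ y ⟧ * ⟦ z ⟧
      ≈⟨ +-cong (+-cong (+-congˡ (-‿cong (absorb x y y⇒x))) (-‿cong (absorb x z z⇒x)))
           (*-congʳ (absorb x y y⇒x)) ⟩
    ⟦ x ⟧ - ⟦ y ⟧ - ⟦ z ⟧ + ⟦ y ⟧ * ⟦ z ⟧ ∎

  ⟦x∧¬y⟧ : ∀ x y → (T y → T x) → ⟦ x ∧ not y ⟧ ≈ ⟦ x ⟧ - ⟦ y ⟧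
  ⟦x∧¬y⟧ x y y⇒x = begin
    ⟦ x ∧ not y ⟧              ≈⟨ trans (⟦∧⟧ x _) (*-congˡ (⟦not⟧ y)) ⟩
    ⟦ x ⟧ * (1# - ⟦ y ⟧)       ≈⟨ solve 2 (λ x y → x :* (:1 :- y) := x :- (x :* y)) refl _ _ ⟩
    ⟦ x ⟧ - ⟦ x ⟧ * ⟦ y ⟧      ≈⟨ +-congˡ (-‿cong (absorb x y y⇒x)) ⟩
    ⟦ x ⟧ - ⟦ y ⟧              ∎

  ⟦¬x∧a⟧ : ∀ x a → (T x → T a) → ⟦ not x ∧ a ⟧ ≈ ⟦ a ⟧ - ⟦ x ⟧
  ⟦¬x∧a⟧ x a x⇒a = begin
    ⟦ not x ∧ a ⟧              ≈⟨ trans (⟦∧⟧ (not x) a) (*-congʳ (⟦not⟧ x)) ⟩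
    (1# - ⟦ x ⟧) * ⟦ a ⟧       ≈⟨ solve 2 (λ x a → (:1 :- x) :* a := a :- (a :* x)) refl _ _ ⟩
    ⟦ a ⟧ - ⟦ a ⟧ * ⟦ x ⟧      ≈⟨ +-congˡ (-‿cong (absorb a x x⇒a)) ⟩
    ⟦ a ⟧ - ⟦ x ⟧              ∎

  ⟦¬x∧a∧b⟧ : ∀ x a b → (T x → T a) → (T x → T b) →
    ⟦ not x ∧ a ∧ b ⟧ ≈ ⟦ a ⟧ * ⟦ b ⟧ - ⟦ x ⟧
  ⟦¬x∧a∧b⟧ x a b x⇒a x⇒b = begin
    ⟦ not x ∧ a ∧ b ⟧
      ≈⟨ trans (⟦∧⟧ (not x) _) (*-cong (⟦not⟧ x) (⟦∧⟧ a b)) ⟩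
    (1# - ⟦ x ⟧) * (⟦ a ⟧ * ⟦ b ⟧)
      ≈⟨ solve 3 (λ x a b → (:1 :- x) :* (a :* b) := a :* b :- b :* (a :* x)) refl _ _ _ ⟩
    ⟦ a ⟧ * ⟦ b ⟧ - ⟦ b ⟧ * (⟦ a ⟧ * ⟦ x ⟧)
      ≈⟨ +-congˡ (-‿cong (trans (*-congˡ (absorb a x x⇒a)) (absorb b x x⇒b))) ⟩
    ⟦ a ⟧ * ⟦ b ⟧ - ⟦ x ⟧ ∎

-- The discrete divergence and its sum over the staircase.

module Toggles {c ℓ} (R : CommutativeRing c ℓ) (n : ℕ) (1≤n : 1 ≤ n) where

  open CommutativeRing R
  open IntegerCoefficients R
  open Summation R
  open Indicators R
  open Algebra.Properties.Ring ring using (-0#≈0#)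
  open Relation.Binary.Reasoning.Setoid setoid

  -- The cell in row 1 + r and column 1 + s is indexed by r and s throughout.
  module Coefficients (q C : Carrier) (A B : ℕ → Carrier)
    (A0≈0 : A 0 ≈ 0#) (Bn≈0 : B n ≈ 0#)
    (off-diagonal : ∀ r s → 1# + q * (B s - A r) ≈ B (suc s) - A (suc r))
    (diagonal : ∀ r → 1# + q * (- A r - C) ≈ B (suc r) + C)
    (T⁻ T⁺ : Staircase n → OrderIdeal n → Carrier)
    (T⁻≡ : ∀ p I → T⁻ p I ≡ ⟦ does (maximalInside? p I) ⟧)
    (T⁺≡ : ∀ p I → T⁺ p I ≡ ⟦ does (minimalOutside? p I) ⟧)
    where

    -- The diagonal has its own coefficient: a cell there has neither a left neighbour nor one in
    -- the next row, so its toggles are linear in χ and take no part in the cancellation of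
    -- quadratic terms.
    weight : ℕ → ℕ → Carrier
    weight r s = if does (r ℕₚ.≟ s) then - A r - C else B s - A r

    coefficient : Staircase n → Carrier
    coefficient p = weight (ℕ.pred (row p)) (ℕ.pred (col p))

    module _ (I : OrderIdeal n) where

      χ : ℕ → ℕ → Carrier
      χ i j = ⟦ isIn I i j ⟧

      summand : Staircase n → Carrier
      summand p = T⁻ p I - coefficient p * (T⁺ p I - q * T⁻ p I)

      -- The potential of the boundary sum along the diagonal. It sits just right of the diagonal,
      -- at (r,r+1): for r = 0 that place is in every ideal, for r = n in none, so the ends of the
      -- telescope do not depend on `I`.
      K : ℕ → Carrier
      K r = (A r + C) * χ r (suc r)

      -- (H , V) is a field whose divergence is the summand: for r < s it is H↗ and
      -- V↗, and its continuation below the diagonal takes care of the cells on it.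
      H↗ V↗ H V : ℕ → ℕ → Carrier
      H↗ r s = (B s - A r) * (χ r (suc s) * χ (suc r) s) - (B s - A (suc r)) * χ (suc r) (suc s)
      V↗ r s = (B (suc s) - A r) * (χ r (suc (suc s)) * χ (suc r) (suc s) - χ (suc r) (suc s))
      H r s = if does (s ℕₚ.≤? r) then K (suc r) - K r else H↗ r s
      V r s = if does (r ℕₚ.≤? s) then V↗ r s else 0#

      H-≤ : ∀ {r s} → s ≤ r → H r s ≡ K (suc r) - K r
      H-≤ {r} {s} s≤r = if-yes (s ℕₚ.≤? r) s≤r

      H-> : ∀ {r s} → r < s → H r s ≡ H↗ r s
      H-> {r} {s} r<s = if-no (s ℕₚ.≤? r) (ℕₚ.<⇒≱ r<s)

      V-≤ : ∀ {r s} → r ≤ s → V r s ≡ V↗ r s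
      V-≤ {r} {s} r≤s = if-yes (r ℕₚ.≤? s) r≤s

      V-> : ∀ {r s} → s < r → V r s ≡ 0#
      V-> {r} {s} s<r = if-no (r ℕₚ.≤? s) (ℕₚ.<⇒≱ s<r)

      regroup : ∀ a t u → t - a * (u - q * t) ≈ (1# + q * a) * t - a * u
      regroup a t u = solve 4 (λ q a t u → t :- a :* (u :- q :* t) := (:1 :+ q :* a) :* t :- a :* u)
        refl q a t u

      summand-off-diagonal : ∀ {r s} .(a : 1 ≤ suc r) .(b : suc r ≤ suc s) .(c : suc s ≤ n) → r < s →
        summand (cell (suc r) (suc s) a b c) ≈ (H↗ r (suc s) - H↗ r s) + (V↗ (suc r) s - V↗ r s)
      summand-off-diagonal {r} {s} a b c r<s = begin
        summand p
          ≈⟨ +-congˡ (-‿cong (*-congʳ (reflexive weight≡))) ⟩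
        T⁻ p I - (B s - A r) * (T⁺ p I - q * T⁻ p I)
          ≈⟨ regroup (B s - A r) (T⁻ p I) (T⁺ p I) ⟩
        (1# + q * (B s - A r)) * T⁻ p I - (B s - A r) * T⁺ p I
          ≈⟨ +-cong (*-cong (off-diagonal r s) T⁻≈) (-‿cong (*-congˡ T⁺≈)) ⟩
        (B (suc s) - A (suc r)) * (x - y - z + y * z) - (B s - A r) * (u * v - x)
          -- The variable `w` occurs on the right only. The quadratic terms `y * z` and `u * v` are
          -- one diagonal step apart; the step is split at the place of `w * x`, which enters
          -- `H↗ r (suc s)` and `V↗ r s` with the same coefficient and cancels.
          ≈⟨ solve 10 (λ b₂ a₁ b₁ a₀ x y z w u v →
               (b₂ :- a₁) :* (x :- y :- z :+ y :* z) :- (b₁ :- a₀) :* (u :* v :- x) :=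
               (((b₂ :- a₀) :* (w :* x) :- (b₂ :- a₁) :* y) :-
                ((b₁ :- a₀) :* (u :* v) :- (b₁ :- a₁) :* x))
               :+ ((b₂ :- a₁) :* (y :* z :- z) :- (b₂ :- a₀) :* (w :* x :- x)))
               refl (B (suc s)) (A (suc r)) (B s) (A r) x y z (χ r (suc (suc s))) u v ⟩
        (H↗ r (suc s) - H↗ r s) + (V↗ (suc r) s - V↗ r s) ∎
        where
        p : Staircase n
        p = cell (suc r) (suc s) a b c
        x y z u v : Carrier
        x = χ (suc r) (suc s)
        y = χ (suc r) (suc (suc s))
        z = χ (suc (suc r)) (suc s)
        u = χ r (suc s)
        v = χ (suc r) s
        weight≡ : weight r s ≡ B s - A r
        weight≡ = if-no (r ℕₚ.≟ s) (ℕₚ.<⇒≢ r<s)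
        r≤s : r ≤ s
        r≤s = ℕₚ.<⇒≤ r<s
        T⁻≈ : T⁻ p I ≈ x - y - z + y * z
        T⁻≈ = trans (reflexive (≡.trans (T⁻≡ p I) (cong ⟦_⟧ (does-maximalInside I p))))
          (⟦x∧¬y∧¬z⟧ (isIn I (suc r) (suc s)) (isIn I (suc r) (suc (suc s))) (isIn I (suc (suc r)) (suc s))
            (isIn-mono I {suc r} ℕₚ.≤-refl (ℕₚ.n≤1+n _) (s≤s r≤s))
            (isIn-mono I {suc (suc r)} {suc r} (ℕₚ.n≤1+n _) ℕₚ.≤-refl (s≤s r≤s)))
        T⁺≈ : T⁺ p I ≈ u * v - x
        T⁺≈ = trans (reflexive (≡.trans (T⁺≡ p I) (cong ⟦_⟧ (does-minimalOutside-< I a b c r<s))))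
          (⟦¬x∧a∧b⟧ (isIn I (suc r) (suc s)) (isIn I r (suc s)) (isIn I (suc r) s)
            (isIn-mono I {suc r} {r} (ℕₚ.n≤1+n _) ℕₚ.≤-refl (ℕₚ.m≤n⇒m≤1+n r≤s))
            (isIn-mono I {suc r} ℕₚ.≤-refl (ℕₚ.n≤1+n _) r<s))

      summand-diagonal : ∀ {r} .(a : 1 ≤ suc r) .(b : suc r ≤ suc r) .(c : suc r ≤ n) →
        summand (cell (suc r) (suc r) a b c) ≈ (H↗ r (suc r) - (K (suc r) - K r)) + (0# - V↗ r r)
      summand-diagonal {r} a b c = begin
        summand p
          ≈⟨ +-congˡ (-‿cong (*-congʳ (reflexive weight≡))) ⟩
        T⁻ p I - (- A r - C) * (T⁺ p I - q * T⁻ p I)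
          ≈⟨ regroup (- A r - C) (T⁻ p I) (T⁺ p I) ⟩
        (1# + q * (- A r - C)) * T⁻ p I - (- A r - C) * T⁺ p I
          ≈⟨ +-cong (*-cong (diagonal r) T⁻≈) (-‿cong (*-congˡ T⁺≈)) ⟩
        (B (suc r) + C) * (x - y) - (- A r - C) * (u - x)
          -- The coefficient `b₁ + c` of `y` splits into `b₁ - a₁`, which belongs to `H↗ r (suc r)`,
          -- and `a₁ + c`, which belongs to `K (suc r)`. As before, `w * x` cancels.
          ≈⟨ solve 8 (λ b₁ a₁ a₀ c x y w u →
               (b₁ :+ c) :* (x :- y) :- (:- a₀ :- c) :* (u :- x) :=
               (((b₁ :- a₀) :* (w :* x) :- (b₁ :- a₁) :* y) :- ((a₁ :+ c) :* y :- (a₀ :+ c) :* u))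
               :+ (:0 :- (b₁ :- a₀) :* (w :* x :- x)))
               refl (B (suc r)) (A (suc r)) (A r) C x y (χ r (suc (suc r))) u ⟩
        (H↗ r (suc r) - (K (suc r) - K r)) + (0# - V↗ r r) ∎
        where
        p : Staircase n
        p = cell (suc r) (suc r) a b c
        x y u : Carrier
        x = χ (suc r) (suc r)
        y = χ (suc r) (suc (suc r))
        u = χ r (suc r)
        weight≡ : weight r r ≡ - A r - C
        weight≡ = if-yes (r ℕₚ.≟ r) ≡.refl
        T⁻≈ : T⁻ p I ≈ x - y
        T⁻≈ = trans (reflexive (≡.trans (T⁻≡ p I) (cong ⟦_⟧ (≡.trans (does-maximalInside I p)
            (cong (λ z → isIn I (suc r) (suc r) ∧ z)
              (≡.trans (cong (λ z → not (isIn I (suc r) (suc (suc r))) ∧ not z)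
                         (isIn-below I {suc r} ℕₚ.≤-refl))
                (∧-identityʳ _)))))))
          (⟦x∧¬y⟧ (isIn I (suc r) (suc r)) (isIn I (suc r) (suc (suc r)))
            (isIn-mono I {suc r} ℕₚ.≤-refl (ℕₚ.n≤1+n _) ℕₚ.≤-refl))
        T⁺≈ : T⁺ p I ≈ u - x
        T⁺≈ = trans (reflexive (≡.trans (T⁺≡ p I) (cong ⟦_⟧ (does-minimalOutside-≡ I a b c ≡.refl))))
          (⟦¬x∧a⟧ (isIn I (suc r) (suc r)) (isIn I r (suc r))
            (isIn-mono I {suc r} {r} (ℕₚ.n≤1+n _) ℕₚ.≤-refl (ℕₚ.n≤1+n _)))

      summand-telescopes : ∀ r s → s < n →
        maybe′ summand 0# (toCell n (suc r , suc s)) ≈ (H r (suc s) - H r s) + (V (suc r) s - V r s)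
      summand-telescopes r s s<n with ℕₚ.<-cmp r s
      ... | tri< r<s _ _ = begin
        maybe′ summand 0# (toCell n (suc r , suc s))
          ≡⟨ cong (maybe′ summand 0#) (toCell-cell (cell (suc r) (suc s) (s≤s z≤n) (s≤s (ℕₚ.<⇒≤ r<s)) s<n)) ⟩
        summand (cell (suc r) (suc s) _ _ _)
          ≈⟨ summand-off-diagonal _ _ _ r<s ⟩
        (H↗ r (suc s) - H↗ r s) + (V↗ (suc r) s - V↗ r s)
          ≡⟨ cong₂ _+_ (cong₂ _-_ (H-> (ℕₚ.m<n⇒m<1+n r<s)) (H-> r<s))
               (cong₂ _-_ (V-≤ r<s) (V-≤ (ℕₚ.<⇒≤ r<s))) ⟨
        (H r (suc s) - H r s) + (V (suc r) s - V r s) ∎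
      ... | tri≈ _ ≡.refl _ = begin
        maybe′ summand 0# (toCell n (suc r , suc r))
          ≡⟨ cong (maybe′ summand 0#) (toCell-cell (cell (suc r) (suc r) (s≤s z≤n) ℕₚ.≤-refl s<n)) ⟩
        summand (cell (suc r) (suc r) _ _ _)
          ≈⟨ summand-diagonal _ _ _ ⟩
        (H↗ r (suc r) - (K (suc r) - K r)) + (0# - V↗ r r)
          ≡⟨ cong₂ _+_ (cong₂ _-_ (H-> ℕₚ.≤-refl) (H-≤ {r} ℕₚ.≤-refl))
               (cong₂ _-_ (V-> {suc r} ℕₚ.≤-refl) (V-≤ {r} ℕₚ.≤-refl)) ⟨
        (H r (suc r) - H r r) + (V (suc r) r - V r r) ∎
      -- There is no cell here, and the divergence is zero as well: below the diagonal `H` is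
      -- constant along the row and `V` vanishes.
      ... | tri> _ _ s<r = begin
        maybe′ summand 0# (toCell n (suc r , suc s))
          ≡⟨ cong (maybe′ summand 0#) (toCell-below (s≤s s<r)) ⟩
        0#
          ≈⟨ trans (+-cong (-‿inverseʳ (K (suc r) - K r)) (-‿inverseʳ 0#)) (+-identityˡ 0#) ⟨
        ((K (suc r) - K r) - (K (suc r) - K r)) + (0# - 0#)
          ≡⟨ cong₂ _+_ (cong₂ _-_ (H-≤ s<r) (H-≤ {r} (ℕₚ.<⇒≤ s<r)))
               (cong₂ _-_ (V-> {suc r} (ℕₚ.m<n⇒m<1+n s<r)) (V-> s<r)) ⟨
        (H r (suc s) - H r s) + (V (suc r) s - V r s) ∎

      -- Column n + 1 is outside every ideal, except in row 0. There the product survives, and its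
      -- coefficient `B n - A 0` has to vanish.
      H-last : ∀ r → r < n → H r n ≈ 0#
      H-last r r<n = begin
        H r n
          ≡⟨ H-> r<n ⟩
        (B n - A r) * (χ r (suc n) * χ (suc r) n) - (B n - A (suc r)) * χ (suc r) (suc n)
          ≈⟨ +-cong (*-congʳ (+-congʳ Bn≈0))
               (-‿cong (*-congˡ (reflexive (cong ⟦_⟧ (isIn-beyond I {suc r} (s≤s z≤n) (ℕₚ.n<1+n n)))))) ⟩
        (0# - A r) * (χ r (suc n) * χ (suc r) n) - (B n - A (suc r)) * 0#
          ≈⟨ solve 5 (λ a x y b c → (:0 :- a) :* (x :* y) :- (b :- c) :* :0 := :- ((a :* x) :* y))
               refl (A r) (χ r (suc n)) (χ (suc r) n) (B n) (A (suc r)) ⟩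
        - (A r * χ r (suc n) * χ (suc r) n)
          ≈⟨ -‿cong (trans (*-congʳ (Aχ≈0 r)) (zeroˡ _)) ⟩
        - 0#
          ≈⟨ -0#≈0# ⟩
        0# ∎
        where
        Aχ≈0 : ∀ r → A r * χ r (suc n) ≈ 0#
        Aχ≈0 zero    = trans (*-congʳ A0≈0) (zeroˡ _)
        Aχ≈0 (suc r) = trans (*-congˡ (reflexive (cong ⟦_⟧ (isIn-beyond I {suc r} (s≤s z≤n) (ℕₚ.n<1+n n))))) (zeroʳ _)

      -- Row 0 is full, so the quadratic term degenerates to the linear one and the two cancel.
      V-first : ∀ s → V 0 s ≈ 0#
      V-first s = solve 2 (λ b x → b :* (:1 :* x :- x) := :0) refl (B (suc s) - A 0) (χ 1 (suc s))

      K-last : K n ≈ 0#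
      K-last = trans (*-congˡ (reflexive (cong ⟦_⟧ (isIn-beyond I 1≤n (ℕₚ.n<1+n n))))) (zeroʳ _)

      ∑-summand : ∑ (cells n) summand ≈ C
      ∑-summand = begin
        ∑ (cells n) summand
          ≈⟨ ∑-cells n summand ⟩
        ∑< n (λ r → ∑< n (λ s → maybe′ summand 0# (toCell n (suc r , suc s))))
          ≈⟨ ∑<-cong n row-sum ⟩
        -- The zeros are padding: they bring the sum over the rows into the form of `∑<-telescope`.
        ∑< n (λ r → (Z (suc r) - Z r) + (0# - 0#))
          ≈⟨ ∑<-telescope n Z (λ _ → 0#) (λ _ → 0#) ⟩
        (Z n - Z 0) + (∑< n (λ _ → 0#) - ∑< n (λ _ → 0#))
          ≈⟨ trans (+-congˡ (-‿inverseʳ _)) (+-identityʳ _) ⟩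
        Z n - Z 0
          ≈⟨ +-cong Zn≈0 (-‿cong Z0≈-C) ⟩
        0# - - C
          ≈⟨ solve 1 (λ c → :0 :- :- c := c) refl C ⟩
        C ∎
        where
        Y Z : ℕ → Carrier
        Y r = ∑< n (V r)
        Z r = Y r - K r
        Zn≈0 : Z n ≈ 0#
        Zn≈0 = begin
          Y n - K n   ≈⟨ +-cong (∑<-zero n (λ s s<n → reflexive (V-> s<n))) (-‿cong K-last) ⟩
          0# - 0#     ≈⟨ -‿inverseʳ 0# ⟩
          0#          ∎
        Z0≈-C : Z 0 ≈ - C
        Z0≈-C = begin
          Y 0 - K 0                  ≈⟨ +-congʳ (∑<-zero n (λ s _ → V-first s)) ⟩
          0# - (A 0 + C) * 1#        ≈⟨ +-congˡ (-‿cong (*-congʳ (+-congʳ A0≈0))) ⟩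
          0# - (0# + C) * 1#         ≈⟨ solve 1 (λ c → :0 :- (:0 :+ c) :* :1 := :- c) refl C ⟩
          - C                        ∎
        row-sum : ∀ r → r < n → ∑< n (λ s → maybe′ summand 0# (toCell n (suc r , suc s))) ≈
                  (Z (suc r) - Z r) + (0# - 0#)
        row-sum r r<n = begin
          ∑< n (λ s → maybe′ summand 0# (toCell n (suc r , suc s)))
            ≈⟨ ∑<-cong n (summand-telescopes r) ⟩
          ∑< n (λ s → (H r (suc s) - H r s) + (V (suc r) s - V r s))
            ≈⟨ ∑<-telescope n (H r) (V (suc r)) (V r) ⟩
          (H r n - H r 0) + (Y (suc r) - Y r)
            -- Column index 0 is never right of the diagonal, so the left end of each row delivers
            -- the increment of `K` that the continuation of `H` has carried there.
            ≈⟨ +-congʳ (+-cong (H-last r r<n) (-‿cong (reflexive (H-≤ {r} z≤n)))) ⟩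
          (0# - (K (suc r) - K r)) + (Y (suc r) - Y r)
            ≈⟨ solve 4 (λ k₁ k₀ y₁ y₀ → (:0 :- (k₁ :- k₀)) :+ (y₁ :- y₀) :=
                 ((y₁ :- k₁) :- (y₀ :- k₀)) :+ (:0 :- :0)) refl _ _ _ _ ⟩
          (Z (suc r) - Z r) + (0# - 0#) ∎

      ∑T⁻-C : ∑ (cells n) (λ p → T⁻ p I) - C ≈ ∑ (cells n) (λ p → coefficient p * (T⁺ p I - q * T⁻ p I))
      ∑T⁻-C = begin
        ∑ (cells n) (λ p → T⁻ p I) - C
          ≈⟨ +-congˡ (-‿cong (trans (sym ∑-summand) (∑-sub (cells n) (λ p → T⁻ p I) _))) ⟩
        ∑ (cells n) (λ p → T⁻ p I) - (∑ (cells n) (λ p → T⁻ p I) - W)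
          ≈⟨ solve 2 (λ t w → t :- (t :- w) := w) refl _ W ⟩
        W ∎
        where
        W : Carrier
        W = ∑ (cells n) (λ p → coefficient p * (T⁺ p I - q * T⁻ p I))

-- q-numbers and the choice of the coefficients.

module QNumbers {c ℓ} (R : CommutativeRing c ℓ) where

  open CommutativeRing R
  open Indicators R using (⟦_⟧)
  open IntegerCoefficients R
  open Summation R using (∑)
  open Relation.Binary.Reasoning.Setoid setoid

  module Recursion (q : Carrier) ([_] : ℕ → Carrier)
    ([0] : [ 0 ] ≈ 0#) ([suc] : ∀ m → [ suc m ] ≈ 1# + q * [ m ])
    where

    -- The factor `1# + q * [ n ] - [ n ]` is qⁿ, written without powers: this is [m+n] = [m] qⁿ +
    -- [n].
    [+] : ∀ m n → [ m ℕ.+ n ] ≈ [ m ] * (1# + q * [ n ] - [ n ]) + [ n ]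
    [+] zero    n = begin
      [ n ]
        ≈⟨ solve 2 (λ x y → x := :0 :* y :+ x) refl _ _ ⟩
      0# * (1# + q * [ n ] - [ n ]) + [ n ]
        ≈⟨ +-congʳ (*-congʳ [0]) ⟨
      [ 0 ] * (1# + q * [ n ] - [ n ]) + [ n ] ∎
    [+] (suc m) n = begin
      [ suc (m ℕ.+ n) ]
        ≈⟨ trans ([suc] (m ℕ.+ n)) (+-congˡ (*-congˡ ([+] m n))) ⟩
      1# + q * ([ m ] * (1# + q * [ n ] - [ n ]) + [ n ])
        ≈⟨ solve 3 (λ q x y → :1 :+ q :* (x :* (:1 :+ q :* y :- y) :+ y) :=
             (:1 :+ q :* x) :* (:1 :+ q :* y :- y) :+ y) refl q [ m ] [ n ] ⟩
      (1# + q * [ m ]) * (1# + q * [ n ] - [ n ]) + [ n ]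
        ≈⟨ +-congʳ (*-congʳ ([suc] m)) ⟨
      [ suc m ] * (1# + q * [ n ] - [ n ]) + [ n ] ∎

    -- Here f is [n-1]!, and d is 1 / (1 + qⁿ) because [2n] = [n] (1 + qⁿ).
    module Solution (n : ℕ) (1/[2n] f 1/[2]!f C : Carrier)
      ([2n]/[2n] : [ 2 ℕ.* n ] * 1/[2n] ≈ 1#)
      ([2]!f/[2]!f : ([ 2 ] * ([ 1 ] * 1#)) * f * 1/[2]!f ≈ 1#)
      (C≈ : C ≈ ([ suc n ] * ([ n ] * f)) * 1/[2]!f * 1/[2n])
      where

      private
        N d : Carrier
        N = [ n ]
        d = N * 1/[2n]

      A B : ℕ → Carrier
      A r = - (d * [ r ])
      B s = d * ([ s ] - N)

      A0≈0 : A 0 ≈ 0#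
      A0≈0 = trans (-‿cong (*-congˡ [0])) (solve 1 (λ d → :- (d :* :0) := :0) refl d)

      Bn≈0 : B n ≈ 0#
      Bn≈0 = trans (*-congˡ (-‿inverseʳ N)) (zeroʳ d)

      d[1+qⁿ]≈1 : d * (1# + 1# + q * N - N) ≈ 1#
      d[1+qⁿ]≈1 = begin
        d * (1# + 1# + q * N - N)
          ≈⟨ solve 3 (λ x i q → x :* i :* (:1 :+ :1 :+ q :* x :- x) :=
               (x :* (:1 :+ q :* x :- x) :+ x) :* i) refl N 1/[2n] q ⟩
        (N * (1# + q * N - N) + N) * 1/[2n]
          ≈⟨ *-congʳ ([+] n n) ⟨
        [ n ℕ.+ n ] * 1/[2n]
          ≡⟨ cong (λ m → [ n ℕ.+ m ] * 1/[2n]) (ℕₚ.+-identityʳ n) ⟨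
        [ 2 ℕ.* n ] * 1/[2n]
          ≈⟨ [2n]/[2n] ⟩
        1# ∎

      off-diagonal : ∀ r s → 1# + q * (B s - A r) ≈ B (suc s) - A (suc r)
      off-diagonal r s = begin
        1# + q * (B s - A r)
          -- Writing 1 as d + d qⁿ provides the inhomogeneous terms of both recursions: d for `A`
          -- and d qⁿ for `B`.
          ≈⟨ +-congʳ d[1+qⁿ]≈1 ⟨
        d * (1# + 1# + q * N - N) + q * (B s - A r)
          ≈⟨ solve 5 (λ q d x a b → d :* (:1 :+ :1 :+ q :* x :- x) :+ q :* (d :* (b :- x) :- :- (d :* a)) :=
               d :* (:1 :+ q :* b :- x) :- :- (d :* (:1 :+ q :* a))) refl q d N [ r ] [ s ] ⟩
        d * (1# + q * [ s ] - N) - - (d * (1# + q * [ r ]))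
          ≈⟨ +-cong (*-congˡ (+-congʳ ([suc] s))) (-‿cong (-‿cong (*-congˡ ([suc] r)))) ⟨
        B (suc s) - A (suc r) ∎

      [2]!f/[2]!f′ : (1# + q) * f * 1/[2]!f ≈ 1#
      [2]!f/[2]!f′ = begin
        (1# + q) * f * 1/[2]!f
          ≈⟨ *-congʳ (*-congʳ (solve 1 (λ q → :1 :+ q :=
               (:1 :+ q :* (:1 :+ q :* :0)) :* ((:1 :+ q :* :0) :* :1)) refl q)) ⟩
        ((1# + q * (1# + q * 0#)) * ((1# + q * 0#) * 1#)) * f * 1/[2]!f
          ≈⟨ *-congʳ (*-congʳ (*-cong (trans ([suc] 1) (+-congˡ (*-congˡ [1]))) (*-congʳ [1]))) ⟨
        ([ 2 ] * ([ 1 ] * 1#)) * f * 1/[2]!f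
          ≈⟨ [2]!f/[2]!f ⟩
        1# ∎
        where
        [1] : [ 1 ] ≈ 1# + q * 0#
        [1] = trans ([suc] 0) (+-congˡ (*-congˡ [0]))

      -- The quotient in the theorem is [n+1] [n] / ([2] [2n]), and [n] / [2n] is `d`; the factor
      -- `1# + q * N` is [n+1].
      C[1+q]≈d[1+n] : C + q * C ≈ d * (1# + q * N)
      C[1+q]≈d[1+n] = begin
        C + q * C
          ≈⟨ +-cong C≈ (*-congˡ C≈) ⟩
        ([ suc n ] * (N * f)) * 1/[2]!f * 1/[2n] + q * (([ suc n ] * (N * f)) * 1/[2]!f * 1/[2n])
          ≈⟨ solve 6 (λ q m x f j i → (m :* (x :* f)) :* j :* i :+ q :* ((m :* (x :* f)) :* j :* i) :=
               x :* i :* m :* ((:1 :+ q) :* f :* j)) refl q [ suc n ] N f 1/[2]!f 1/[2n] ⟩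
        d * [ suc n ] * ((1# + q) * f * 1/[2]!f)
          ≈⟨ *-congˡ [2]!f/[2]!f′ ⟩
        d * [ suc n ] * 1#
          ≈⟨ trans (*-identityʳ _) (*-congˡ ([suc] n)) ⟩
        d * (1# + q * N) ∎

      diagonal : ∀ r → 1# + q * (- A r - C) ≈ B (suc r) + C
      diagonal r = begin
        1# + q * (- A r - C)
          ≈⟨ +-congʳ d[1+qⁿ]≈1 ⟨
        d * (1# + 1# + q * N - N) + q * (- A r - C)
          -- Here d (1 + qⁿ) is split as d [n+1] + d (1 - [n]): the first part is C + q C, the
          -- second joins d q [r] to form `B (suc r)`.
          ≈⟨ solve 5 (λ q d x a c → d :* (:1 :+ :1 :+ q :* x :- x) :+ q :* (:- (:- (d :* a)) :- c) :=
               d :* (:1 :+ q :* x) :+ (d :* (:1 :+ q :* a :- x) :- q :* c)) refl q d N [ r ] C ⟩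
        d * (1# + q * N) + (d * (1# + q * [ r ] - N) - q * C)
          ≈⟨ +-cong C[1+q]≈d[1+n] (+-congʳ (*-congˡ (+-congʳ ([suc] r)))) ⟨
        (C + q * C) + (B (suc r) - q * C)
          ≈⟨ solve 3 (λ q c b → (c :+ q :* c) :+ (b :- q :* c) := b :+ c) refl q C (B (suc r)) ⟩
        B (suc r) + C ∎

      toggleability : 1 ≤ n → (T⁻ T⁺ : Staircase n → OrderIdeal n → Carrier) →
        (∀ p I → T⁻ p I ≡ ⟦ does (maximalInside? p I) ⟧) →
        (∀ p I → T⁺ p I ≡ ⟦ does (minimalOutside? p I) ⟧) →
        ∃[ a ] ∀ I → ∑ (cells n) (λ p → T⁻ p I) - C ≈ ∑ (cells n) (λ p → a p * (T⁺ p I - q * T⁻ p I))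
      toggleability 1≤n T⁻ T⁺ T⁻≡ T⁺≡ = T.coefficient , T.∑T⁻-C
        where
        module T = Toggles.Coefficients R n 1≤n q C A B A0≈0 Bn≈0 off-diagonal diagonal T⁻ T⁺ T⁻≡ T⁺≡

-- Specialisation to rational functions.

open import Data.Nat.Base using (_+_; _*_)

module _ {c ℓ₁ ℓ₂} (F : HeytingField c ℓ₁ ℓ₂) where

  open RationalFunctions F
  open RationalFunctionRing F

  []q!*[]q!-nonzero : ∀ m k → Nonzeroᶠ ([ k ]q! *ᶠ [ m ∸ k ]q!)
  []q!*[]q!-nonzero m k = *ᶠ-nonzero {[ k ]q!} {[ m ∸ k ]q!} ([]q!-nonzero k) ([]q!-nonzero (m ∸ k))

  -- For n = k + 1 the truncated difference `n + 1 ∸ 2` is k, and [n+1]! unfolds by computation to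
  -- [n+1] [n] [k]!. The factor [k]! stays on both sides of the fraction bar and is cancelled only
  -- in the abstract ring.
  qBinomial-2/ : ∀ n → 1 ≤ n → ∀ x x≉0 → qBinomial (n + 1) 2 / x ⟨ x≉0 ⟩ ≈ᶠ
    ([ suc n ]q *ᶠ ([ n ]q *ᶠ [ n + 1 ∸ 2 ]q!))
      *ᶠ recip ([ 2 ]q! *ᶠ [ n + 1 ∸ 2 ]q!) ([]q!*[]q!-nonzero (n + 1) 2) *ᶠ recip x x≉0
  qBinomial-2/ n@(suc k) _ x x≉0 rewrite ℕₚ.+-comm k 1 =
    /-/ [ suc n ]q! ([ 2 ]q! *ᶠ [ k ]q!) x ([]q!*[]q!-nonzero (suc n) 2) x≉0

module _ {c ℓ₁ ℓ₂} (F : HeytingField c ℓ₁ ℓ₂) (n : ℕ) where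

  open RationalFunctions F
  open RationalFunctionRing F
  open Summation rationalFunctionRing
  open Toggleability F n
  private module R = CommutativeRing rationalFunctionRing

  -- The value of C is left open here to keep the terms to be compared small.
  ∑P-≡ᵠ-constant : ∀ C →
    (∃[ a ] ∀ I → ∑ (cells n) (λ p → T⁻ p I) R.- C R.≈
                  ∑ (cells n) (λ p → a p R.* (T⁺ p I R.- q R.* T⁻ p I))) →
    (λ I → ∑P (λ p → T⁻ p I)) ≡ᵠ constant C
  ∑P-≡ᵠ-constant C h = h

  ∑T⁻≡ᵠ : 1 ≤ n → ∀ [2n]≉0 →
    (λ I → ∑P (λ p → T⁻ p I)) ≡ᵠ constant (qBinomial (n + 1) 2 / [ 2 * n ]q ⟨ [2n]≉0 ⟩)
  ∑T⁻≡ᵠ 1≤n [2n]≉0 = ∑P-≡ᵠ-constant (qBinomial (n + 1) 2 / [ 2 * n ]q ⟨ [2n]≉0 ⟩)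
    (QNumbers.Recursion.Solution.toggleability rationalFunctionRing q [_]q
      -- `[ 0 ]q` is the empty polynomial and hence `0ᶠ` by computation.
      (λ _ → HeytingField.refl F) []q-suc n
      (recip [ 2 * n ]q [2n]≉0) [ n + 1 ∸ 2 ]q!
      (recip ([ 2 ]q! *ᶠ [ n + 1 ∸ 2 ]q!) ([]q!*[]q!-nonzero F (n + 1) 2))
      (qBinomial (n + 1) 2 / [ 2 * n ]q ⟨ [2n]≉0 ⟩)
      (recip-inverseʳ [ 2 * n ]q [2n]≉0)
      (recip-inverseʳ ([ 2 ]q! *ᶠ [ n + 1 ∸ 2 ]q!) ([]q!*[]q!-nonzero F (n + 1) 2))
      (qBinomial-2/ F n 1≤n [ 2 * n ]q [2n]≉0)
      1≤n T⁻ T⁺ (λ _ _ → ≡.refl) (λ _ _ → ≡.refl))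

theorem5p15 : ∀ {c ℓ₁ ℓ₂ ℓ₃} (ℝ : RealNumbers c ℓ₁ ℓ₂ ℓ₃) (n : ℕ) (1≤n : 1 ≤ n) →
    let open RationalFunctions (RealNumbers.heytingField ℝ)
        open Toggleability (RealNumbers.heytingField ℝ) n
    in (λ I → ∑P (λ p → T⁻ p I))
         ≡ᵠ constant (qBinomial (n + 1) 2 / [ 2 * n ]q ⟨ []q-nonzero (1≤2*n 1≤n) ⟩)
theorem5p15 ℝ n 1≤n =
  ∑T⁻≡ᵠ (RealNumbers.heytingField ℝ) n 1≤n
    (RationalFunctions.[]q-nonzero (RealNumbers.heytingField ℝ) (1≤2*n 1≤n))
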